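{- Let $\delta>0$, and let $n=pq$ denote a public integer that is the product of two unknown primes $q<p<2q$. (1) Let $\kappa>2$. If $p+q=K+U$ is a $\delta$-approximation of $p+q$ with $K\ge \kappa\sqrt n$, then one can find a $\delta$-approximation of $p$ and a $\delta$-approximation of $q$ in polynomial time. Precisely: there is a polynomial-time algorithm which, on input $n$ and $K$, outputs integers $K_p,K_q$ such that for every $C>0$ there is a constant $c>0$ depending only on $C,\delta,\kappa$ such that, whenever $K\ge\kappa\sqrt n$ and $|p+q-K|<C(p+q)^{1-\delta}$, one has $|p-K_p|<c\,p^{1-\delta}$ and $|q-K_q|<c\,q^{1-\delta}$. (2) Conversely, given a $\delta$-approximation of $p$ and a $\delta$-approximation of $q$, one can find a $\delta$-approximation of $p+q$ in polynomial time. Precisely: there is a polynomial-time algorithm which, on input $n$ and integers $K_p,K_q$, outputs an integer $K$ such that for every $C>0$ there is a constant $c>0$ depending only on $C,\delta$ such that, whenever $|p-K_p|<C p^{1-\delta}$ and $|q-K_q|<C q^{1-\delta}$, one has $|p+q-K|<c\,(p+q)^{1-\delta}$.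
   Context: Definition. Let $m$ be an unknown integer and $\delta>0$. Integers $K,U$ are a $\delta$-approximation of $m$ if $m=K+U$, $K$ is known, and $|U|<c\,m^{1-\delta}$ for some constant $c$. Here "known" means available to the algorithm as input (for hypotheses) or computed by it as output (for conclusions); $n$ is public, i.e. always known, while $p,q$ and the remainder $U$ are not. Constants may differ from one occurrence to another but do not depend on $n,p,q$. Polynomial time means polynomial in the bit length of the input. -}

module Defs where

open import Data.Empty using (⊥)
open import Data.Fin using (Fin)
open import Data.Integer as ℤ using (ℤ; +_; -[1+_]; 0ℤ)
open import Data.Nat as ℕ using (ℕ; suc)
open import Data.Nat.Logarithm using (⌈log₂_⌉)
open import Data.Product using (Σ; ∃; ∃-syntax; _×_; _,_)
open import Data.Rational as ℚ using (ℚ; 0ℚ; 1ℚ; ↥_; ↧ₙ_)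
open import Data.Sum using (_⊎_)
open import Data.Vec as Vec using (Vec; lookup; _[_]≔_; replicate; _++_)
open import Relation.Binary.PropositionalEquality using (_≡_)

open import Algebra.Definitions.RawSemiring ℚ.+-*-rawSemiring using (_^_)

------------------------------------------------------------------------
-- Real numbers

-- The arithmetic below is given by the usual Dedekind formulas on pairs of
-- sets of rationals; applied to Dedekind reals they yield the cuts of the
-- corresponding real numbers.

record Cut : Set₁ where
  field
    lower : ℚ → Set
    upper : ℚ → Set

open Cut public

record IsDedekind (x : Cut) : Set where
  field
    lower-inhabited : ∃ (lower x)
    upper-inhabited : ∃ (upper x)
    lower-closed    : ∀ {a b} → a ℚ.< b → lower x b → lower x a
    upper-closed    : ∀ {a b} → a ℚ.< b → upper x a → upper x b
    lower-open      : ∀ {a} → lower x a → ∃[ b ] (a ℚ.< b × lower x b)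
    upper-open      : ∀ {b} → upper x b → ∃[ a ] (a ℚ.< b × upper x a)
    disjoint        : ∀ {a} → lower x a → upper x a → ⊥
    located         : ∀ {a b} → a ℚ.< b → lower x a ⊎ upper x b

record ℝ : Set₁ where
  field
    cut        : Cut
    isDedekind : IsDedekind cut

open ℝ public

infix  4 _<ᴿ_ _≤ᴿ_
infixl 6 _-ᴿ_
infixl 7 _*ᴿ_
infixr 8 _^ᴿ_

_<ᴿ_ : Cut → Cut → Set
x <ᴿ y = ∃[ a ] (upper x a × lower y a)

_≤ᴿ_ : Cut → Cut → Set
x ≤ᴿ y = ∀ a → lower x a → lower y a

fromℚ : ℚ → Cut
fromℚ r = record { lower = ℚ._< r ; upper = r ℚ.<_ }

fromℤ : ℤ → Cut
fromℤ z = fromℚ (z ℚ./ 1)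

_-ᴿ_ : Cut → Cut → Cut
x -ᴿ y = record
  { lower = λ r → ∃[ a ] ∃[ b ] (lower x a × upper y b × r ℚ.< a ℚ.- b)
  ; upper = λ r → ∃[ a ] ∃[ b ] (upper x a × lower y b × a ℚ.- b ℚ.< r)
  }

-- If a < x < b and c < y < d, then x * y lies strictly between the minimum and
-- the maximum of the four corner products, whatever the signs.
_*ᴿ_ : Cut → Cut → Cut
x *ᴿ y = record
  { lower = λ r → ∃[ a ] ∃[ b ] ∃[ c ] ∃[ d ]
      (lower x a × upper x b × lower y c × upper y d ×
       r ℚ.< a ℚ.* c × r ℚ.< a ℚ.* d × r ℚ.< b ℚ.* c × r ℚ.< b ℚ.* d)
  ; upper = λ r → ∃[ a ] ∃[ b ] ∃[ c ] ∃[ d ]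
      (lower x a × upper x b × lower y c × upper y d ×
       a ℚ.* c ℚ.< r × a ℚ.* d ℚ.< r × b ℚ.* c ℚ.< r × b ℚ.* d ℚ.< r)
  }

√_ : ℕ → Cut
√ n = record
  { lower = λ r → r ℚ.< 0ℚ ⊎ r ℚ.* r ℚ.< + n ℚ./ 1
  ; upper = λ r → 0ℚ ℚ.< r × + n ℚ./ 1 ℚ.< r ℚ.* r
  }

-- The positive and negative parts of an integer.
_⁺ _⁻ : ℤ → ℕ
(+ k)      ⁺ = k
(-[1+ k ]) ⁺ = 0
(+ k)      ⁻ = 0
(-[1+ k ]) ⁻ = suc k

-- The cut of m ^ s for m ≥ 1 and rational s = i / j: for b > 0, b < m ^ (i / j)
-- means b ^ j < m ^ i, with the factor m ^ (i ⁻) moved to the other side so that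
-- all exponents are natural numbers.
_^ℚ_ : ℕ → ℚ → Cut
m ^ℚ s = record
  { lower = λ b → b ℚ.< 0ℚ ⊎ (b ^ j) ℚ.* (m′ ^ (i ⁻)) ℚ.< m′ ^ (i ⁺)
  ; upper = λ b → 0ℚ ℚ.< b × m′ ^ (i ⁺) ℚ.< (b ^ j) ℚ.* (m′ ^ (i ⁻))
  }
  where
  m′ : ℚ
  m′ = + m ℚ./ 1
  i : ℤ
  i = ↥ s
  j : ℕ
  j = ↧ₙ s

-- For m ≥ 1 the power m ^ x with real exponent is both the supremum of m ^ s
-- over rational s < x and the infimum of m ^ s over rational s > x.
_^ᴿ_ : ℕ → Cut → Cut
m ^ᴿ x = record
  { lower = λ b → ∃[ s ] (lower x s × lower (m ^ℚ s) b)
  ; upper = λ b → ∃[ s ] (upper x s × upper (m ^ℚ s) b)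
  }

-- K is a δ-approximation of m with constant c; the remainder is U = m - K.
IsApprox : (δ c : ℝ) → ℕ → ℤ → Set
IsApprox δ c m K =
  fromℤ (+ ℤ.∣ + m ℤ.- K ∣) <ᴿ cut c *ᴿ m ^ᴿ (fromℚ 1ℚ -ᴿ cut δ)

------------------------------------------------------------------------
-- Polynomial time

-- The machine model is a structured random access machine with finitely many
-- integer registers and logarithmic cost: every operation is charged the bit
-- lengths of the integers it reads and writes. It is polynomially equivalent to
-- Turing machines.

data Expr (r : ℕ) : Set where
  const           : ℤ → Expr r
  copy half       : Fin r → Expr r
  add sub mul     : Fin r → Fin r → Expr r

infix  5 _≔_
infixr 4 _⨾_

data Cmd (r : ℕ) : Set where
  skip         : Cmd r
  _≔_          : Fin r → Expr r → Cmd r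
  _⨾_          : Cmd r → Cmd r → Cmd r
  ifPos_⟨_⟩⟨_⟩ : Fin r → Cmd r → Cmd r → Cmd r
  whilePos_⟨_⟩ : Fin r → Cmd r → Cmd r

State : ℕ → Set
State r = Vec ℤ r

-- One sign bit and the binary digits of the absolute value.
bits : ℤ → ℕ
bits z = suc ⌈log₂ suc ℤ.∣ z ∣ ⌉

size : ∀ {k} → Vec ℤ k → ℕ
size xs = Vec.sum (Vec.map bits xs)

module _ {r : ℕ} (σ : State r) where

  value : Expr r → ℤ
  value (const z) = z
  value (copy i)  = lookup σ i
  value (half i)  = lookup σ i ℤ./ℕ 2
  value (add i j) = lookup σ i ℤ.+ lookup σ j
  value (sub i j) = lookup σ i ℤ.- lookup σ j
  value (mul i j) = lookup σ i ℤ.* lookup σ j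

  readCost : Expr r → ℕ
  readCost (const z) = 0
  readCost (copy i)  = bits (lookup σ i)
  readCost (half i)  = bits (lookup σ i)
  readCost (add i j) = bits (lookup σ i) ℕ.+ bits (lookup σ j)
  readCost (sub i j) = bits (lookup σ i) ℕ.+ bits (lookup σ j)
  readCost (mul i j) = bits (lookup σ i) ℕ.+ bits (lookup σ j)

-- ⟨ P , σ ⟩⇓ τ [ t ]: started in σ, P halts in τ at total cost t.
data ⟨_,_⟩⇓_[_] {r : ℕ} : Cmd r → State r → State r → ℕ → Set where

  ⇓skip : ∀ {σ} → ⟨ skip , σ ⟩⇓ σ [ 1 ]

  ⇓assign : ∀ {σ i e} →
    ⟨ i ≔ e , σ ⟩⇓ (σ [ i ]≔ value σ e) [ readCost σ e ℕ.+ bits (value σ e) ]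

  ⇓seq : ∀ {σ σ′ σ″ P Q t u} →
    ⟨ P , σ ⟩⇓ σ′ [ t ] → ⟨ Q , σ′ ⟩⇓ σ″ [ u ] →
    ⟨ P ⨾ Q , σ ⟩⇓ σ″ [ t ℕ.+ u ]

  ⇓then : ∀ {σ σ′ i P Q t} →
    0ℤ ℤ.< lookup σ i → ⟨ P , σ ⟩⇓ σ′ [ t ] →
    ⟨ ifPos i ⟨ P ⟩⟨ Q ⟩ , σ ⟩⇓ σ′ [ bits (lookup σ i) ℕ.+ t ]

  ⇓else : ∀ {σ σ′ i P Q t} →
    lookup σ i ℤ.≤ 0ℤ → ⟨ Q , σ ⟩⇓ σ′ [ t ] →
    ⟨ ifPos i ⟨ P ⟩⟨ Q ⟩ , σ ⟩⇓ σ′ [ bits (lookup σ i) ℕ.+ t ]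

  ⇓stop : ∀ {σ i P} →
    lookup σ i ℤ.≤ 0ℤ →
    ⟨ whilePos i ⟨ P ⟩ , σ ⟩⇓ σ [ bits (lookup σ i) ]

  ⇓loop : ∀ {σ σ′ σ″ i P t u} →
    0ℤ ℤ.< lookup σ i → ⟨ P , σ ⟩⇓ σ′ [ t ] →
    ⟨ whilePos i ⟨ P ⟩ , σ′ ⟩⇓ σ″ [ u ] →
    ⟨ whilePos i ⟨ P ⟩ , σ ⟩⇓ σ″ [ bits (lookup σ i) ℕ.+ (t ℕ.+ u) ]

-- The input fills the first k registers and the w work registers start at 0; the
-- output is read off the registers named by `out`. As bits z ≥ 1, the bounds
-- a * s ^ d dominate every polynomial in the size s of a nonempty input.
record PolyTimeAlgorithm (k l : ℕ) : Set where
  field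
    w        : ℕ
    program  : Cmd (k ℕ.+ w)
    out      : Vec (Fin (k ℕ.+ w)) l
    result   : Vec ℤ k → Vec ℤ l
    a d      : ℕ
    computes : ∀ xs → Σ (State (k ℕ.+ w)) λ τ → Σ ℕ λ t →
      ⟨ program , xs ++ replicate w 0ℤ ⟩⇓ τ [ t ] ×
      Vec.map (lookup τ) out ≡ result xs ×
      t ℕ.≤ a ℕ.* size xs ℕ.^ d

open PolyTimeAlgorithm public using (result)

{-# OPTIONS --safe #-}
-- Part (1): put S = p + q, D = p - q, U = S - K and F = ⌊√(K² - 4n)⌋, and output
-- ⌊(K + F) / 2⌋ and its complement to K. Since S² - D² = 4n, (D - F)(D + F) differs from
-- U (S + K) by less than 2F + 1. The hypothesis K ≥ κ √n with κ > 2 keeps K² - 4n ≥ K² / G for a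
-- constant G, so S + K ≤ 3 G (D + F) and |D - F| ≤ 3 G |U| + 2. The additive constants
-- coming from rounding are absorbed into O(|U|) because U is an integer; if U = 0 then K² - 4n = D²
-- and the output is exact. (For δ > 1 this matters: p ^ (1 - δ) is then not bounded below.)
-- Part (2) outputs the sum of the approximations. In both parts p, q and p + q are within a factor 3
-- of each other, and so are their (1 - δ)-th powers up to a factor 3 ^ M.
module Submission where

open import Algebra.Bundles using (CommutativeRing)
open import Data.Fin.Patterns using (0F; 1F; 2F; 3F; 4F; 5F; 6F; 7F; 8F)
open import Data.Integer as ℤ using (ℤ; +_; -[1+_])
import Data.Integer.DivMod as ℤ
import Data.Integer.Properties as ℤₚ
import Data.Integer.Tactic.RingSolver as ℤ-Ring
import Data.List as List
open import Data.Nat as ℕ using (ℕ; zero; suc)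
import Data.Nat.DivMod as ℕ
open import Data.Nat.Logarithm
  using (⌈log₂_⌉; ⌈log₂⌉-mono-≤; ⌈log₂⌈n/2⌉⌉≡⌈log₂n⌉∸1; ⌈log₂2^n⌉≡n)
open import Data.Nat.Primality using (Prime; prime⇒nonTrivial)
import Data.Nat.Properties as ℕₚ
import Data.Nat.Tactic.RingSolver as ℕ-Ring
open import Data.Product using (Σ; _×_; _,_; ∃-syntax; proj₁; proj₂)
open import Data.Rational as ℚ using (ℚ; 0ℚ; 1ℚ; ↥_; ↧_; ↧ₙ_; *<*; *≤*)
import Data.Rational.Literals as Literals
import Data.Rational.Properties as ℚₚ
open import Data.Rational.Solver using (module +-*-Solver)
import Data.Rational.Unnormalised as ℚᵘ
import Data.Rational.Unnormalised.Properties as ℚᵘₚ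
open import Data.Sum using (_⊎_; inj₁; inj₂; [_,_]′)
open import Data.Vec as Vec using (_∷_; []; lookup; replicate)
open import Relation.Binary.PropositionalEquality
  using (_≡_; refl; sym; trans; cong; cong₂; subst; subst₂)
open import Relation.Nullary using (yes; no; contradiction)
open import Algebra.Properties.CommutativeSemiring.Exp
  (CommutativeRing.commutativeSemiring ℚₚ.+-*-commutativeRing)
  using (_^_; ^-distrib-*; ^-homo-*; ^-assocʳ)
open import Defs

-- Rational powers

≤⇒≯ : ∀ {p q} → p ℚ.≤ q → q ℚ.≮ p
≤⇒≯ p≤q q<p = ℚₚ.<-irrefl refl (ℚₚ.<-≤-trans q<p p≤q)

ι : ℤ → ℚ
ι z = z ℚ./ 1

ι≡fromℤ : ∀ z → ι z ≡ Literals.fromℤ z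
ι≡fromℤ z = ℚₚ.↥p/↧p≡p (Literals.fromℤ z)

ι-mono-< : ∀ {z w} → z ℤ.< w → ι z ℚ.< ι w
ι-mono-< {z} {w} z<w rewrite ι≡fromℤ z | ι≡fromℤ w =
  *<* (subst₂ ℤ._<_ (sym (ℤₚ.*-identityʳ z)) (sym (ℤₚ.*-identityʳ w)) z<w)

ι-mono-≤ : ∀ {z w} → z ℤ.≤ w → ι z ℚ.≤ ι w
ι-mono-≤ {z} {w} z≤w rewrite ι≡fromℤ z | ι≡fromℤ w =
  *≤* (subst₂ ℤ._≤_ (sym (ℤₚ.*-identityʳ z)) (sym (ℤₚ.*-identityʳ w)) z≤w)

ι-cancel-< : ∀ {z w} → ι z ℚ.< ι w → z ℤ.< w
ι-cancel-< {z} {w} z<w =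
  ℤₚ.≰⇒> λ w≤z → ≤⇒≯ (ι-mono-≤ w≤z) z<w

ι-cancel-≤ : ∀ {z w} → ι z ℚ.≤ ι w → z ℤ.≤ w
ι-cancel-≤ z≤w = ℤₚ.≮⇒≥ λ w<z → ≤⇒≯ z≤w (ι-mono-< w<z)

ι-* : ∀ z w → ι z ℚ.* ι w ≡ ι (z ℤ.* w)
ι-* z w = cong₂ ℚ._*_ (ι≡fromℤ z) (ι≡fromℤ w)

p<1+∣↥p∣ : ∀ p → p ℚ.< ι (+ suc ℤ.∣ ↥ p ∣)
p<1+∣↥p∣ p@(ℚ.mkℚ n d _) rewrite ι≡fromℤ (+ suc ℤ.∣ n ∣) =
  *<* (begin-strict
    n ℤ.* + 1                       ≡⟨ ℤₚ.*-identityʳ n ⟩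
    n                               ≤⟨ i≤+∣i∣ n ⟩
    + ℤ.∣ n ∣                       <⟨ ℤ.+<+ (ℕₚ.n<1+n _) ⟩
    + suc ℤ.∣ n ∣                   ≤⟨ ℤ.+≤+ (ℕₚ.m≤m*n (suc ℤ.∣ n ∣) (suc d)) ⟩
    + (suc ℤ.∣ n ∣ ℕ.* suc d)       ≡⟨ ℤₚ.pos-* (suc ℤ.∣ n ∣) (suc d) ⟩
    + suc ℤ.∣ n ∣ ℤ.* + suc d       ∎)
  where
  open ℤₚ.≤-Reasoning
  i≤+∣i∣ : ∀ i → i ℤ.≤ + ℤ.∣ i ∣
  i≤+∣i∣ (+ _)     = ℤₚ.≤-refl
  i≤+∣i∣ (-[1+ _ ]) = ℤ.-≤+

*-monoˡ-≤ : ∀ {r p q} → 0ℚ ℚ.≤ r → p ℚ.≤ q → r ℚ.* p ℚ.≤ r ℚ.* q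
*-monoˡ-≤ {r} 0≤r = ℚₚ.*-monoˡ-≤-nonNeg r ⦃ ℚ.nonNegative 0≤r ⦄

*-monoʳ-≤ : ∀ {r p q} → 0ℚ ℚ.≤ r → p ℚ.≤ q → p ℚ.* r ℚ.≤ q ℚ.* r
*-monoʳ-≤ {r} 0≤r = ℚₚ.*-monoʳ-≤-nonNeg r ⦃ ℚ.nonNegative 0≤r ⦄

*-mono-≤ : ∀ {p q r s} → 0ℚ ℚ.≤ r → 0ℚ ℚ.≤ q → p ℚ.≤ q → r ℚ.≤ s → p ℚ.* r ℚ.≤ q ℚ.* s
*-mono-≤ 0≤r 0≤q p≤q r≤s = ℚₚ.≤-trans (*-monoʳ-≤ 0≤r p≤q) (*-monoˡ-≤ 0≤q r≤s)

*-monoˡ-< : ∀ {r p q} → 0ℚ ℚ.< r → p ℚ.< q → r ℚ.* p ℚ.< r ℚ.* q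
*-monoˡ-< {r} 0<r = ℚₚ.*-monoʳ-<-pos r ⦃ ℚ.positive 0<r ⦄

*-monoʳ-< : ∀ {r p q} → 0ℚ ℚ.< r → p ℚ.< q → p ℚ.* r ℚ.< q ℚ.* r
*-monoʳ-< {r} 0<r = ℚₚ.*-monoˡ-<-pos r ⦃ ℚ.positive 0<r ⦄

*-pos : ∀ {p q} → 0ℚ ℚ.< p → 0ℚ ℚ.< q → 0ℚ ℚ.< p ℚ.* q
*-pos {p} {q} 0<p 0<q = subst (ℚ._< p ℚ.* q) (ℚₚ.*-zeroʳ p) (*-monoˡ-< 0<p 0<q)

*-cancelˡ-< : ∀ {r p q} → 0ℚ ℚ.≤ r → r ℚ.* p ℚ.< r ℚ.* q → p ℚ.< q
*-cancelˡ-< {r} 0≤r = ℚₚ.*-cancelˡ-<-nonNeg r ⦃ ℚ.nonNegative 0≤r ⦄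

*-cancelʳ-< : ∀ {r p q} → 0ℚ ℚ.≤ r → p ℚ.* r ℚ.< q ℚ.* r → p ℚ.< q
*-cancelʳ-< {r} 0≤r = ℚₚ.*-cancelʳ-<-nonNeg r ⦃ ℚ.nonNegative 0≤r ⦄

0<1 : 0ℚ ℚ.< 1ℚ
0<1 = ι-mono-< {+ 0} {+ 1} (ℤ.+<+ (ℕ.s≤s ℕ.z≤n))

^-pos : ∀ {x} n → 0ℚ ℚ.< x → 0ℚ ℚ.< x ^ n
^-pos zero    0<x = 0<1
^-pos (suc n) 0<x = *-pos 0<x (^-pos n 0<x)

^-monoˡ-≤ : ∀ {x y} n → 0ℚ ℚ.< x → x ℚ.≤ y → x ^ n ℚ.≤ y ^ n
^-monoˡ-≤ zero    0<x x≤y = ℚₚ.≤-refl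
^-monoˡ-≤ (suc n) 0<x x≤y =
  *-mono-≤ (ℚₚ.<⇒≤ (^-pos n 0<x)) (ℚₚ.≤-trans (ℚₚ.<⇒≤ 0<x) x≤y) x≤y (^-monoˡ-≤ n 0<x x≤y)

1≤x⇒1≤x^n : ∀ {x} n → 1ℚ ℚ.≤ x → 1ℚ ℚ.≤ x ^ n
1≤x⇒1≤x^n         zero    1≤x = ℚₚ.≤-refl
1≤x⇒1≤x^n {x} (suc n) 1≤x =
  *-mono-≤ (ℚₚ.<⇒≤ 0<1) (ℚₚ.≤-trans (ℚₚ.<⇒≤ 0<1) 1≤x) 1≤x (1≤x⇒1≤x^n n 1≤x)

^-monoʳ-≤ : ∀ {x m n} → 1ℚ ℚ.≤ x → m ℕ.≤ n → x ^ m ℚ.≤ x ^ n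
^-monoʳ-≤ {n = n} 1≤x ℕ.z≤n = 1≤x⇒1≤x^n n 1≤x
^-monoʳ-≤ 1≤x (ℕ.s≤s m≤n)   = *-monoˡ-≤ (ℚₚ.≤-trans (ℚₚ.<⇒≤ 0<1) 1≤x) (^-monoʳ-≤ 1≤x m≤n)

x^n<1⇒x<1 : ∀ {x} n → x ^ n ℚ.< 1ℚ → x ℚ.< 1ℚ
x^n<1⇒x<1 n x^n<1 = ℚₚ.≰⇒> λ 1≤x → ≤⇒≯ (1≤x⇒1≤x^n n 1≤x) x^n<1


^-ratio : ∀ {x y r} n → 0ℚ ℚ.< x → x ℚ.≤ r ℚ.* y → x ^ n ℚ.≤ r ^ n ℚ.* y ^ n
^-ratio {x} {y} {r} n 0<x x≤ry =
  subst (x ^ n ℚ.≤_) (^-distrib-* r y n) (^-monoˡ-≤ n 0<x x≤ry)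

-- Replacing `y ^ b` by `x ^ b` and `x ^ a` by `y ^ a` costs the factors `r ^ b` and `r ^ a`.
-- Together they are at most `r ^ (M * j)`, the `j`-th power of `r ^ M`. Read with exponent
-- `(a - b) / j`, this passes from the base `x` to the base `y`.
scale-power-bound : ∀ {r x y e} M j a b →
  1ℚ ℚ.≤ r → 0ℚ ℚ.< x → 0ℚ ℚ.< y → x ℚ.≤ r ℚ.* y → y ℚ.≤ r ℚ.* x →
  0ℚ ℚ.< e → a ℕ.+ b ℕ.≤ M ℕ.* j →
  (e ℚ.* r ^ M) ^ j ℚ.* x ^ b ℚ.< x ^ a →
  e ^ j ℚ.* y ^ b ℚ.< y ^ a
scale-power-bound {r} {x} {y} {e} M j a b 1≤r 0<x 0<y x≤ry y≤rx 0<e a+b≤Mj h =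
  *-cancelʳ-< (ℚₚ.<⇒≤ (^-pos a 0<r)) (begin-strict
    e ^ j ℚ.* y ^ b ℚ.* r ^ a
      ≤⟨ *-monoʳ-≤ (ℚₚ.<⇒≤ (^-pos a 0<r))
           (*-monoˡ-≤ (ℚₚ.<⇒≤ (^-pos j 0<e)) (^-ratio b 0<y y≤rx)) ⟩
    e ^ j ℚ.* (r ^ b ℚ.* x ^ b) ℚ.* r ^ a
      ≡⟨ solve 4 (λ E B X A → E :* (B :* X) :* A := E :* (A :* B) :* X) refl
           (e ^ j) (r ^ b) (x ^ b) (r ^ a) ⟩
    e ^ j ℚ.* (r ^ a ℚ.* r ^ b) ℚ.* x ^ b
      ≡⟨ cong (λ z → e ^ j ℚ.* z ℚ.* x ^ b) (^-homo-* r a b) ⟨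
    e ^ j ℚ.* r ^ (a ℕ.+ b) ℚ.* x ^ b
      ≤⟨ *-monoʳ-≤ (ℚₚ.<⇒≤ (^-pos b 0<x))
           (*-monoˡ-≤ (ℚₚ.<⇒≤ (^-pos j 0<e)) (^-monoʳ-≤ 1≤r a+b≤Mj)) ⟩
    e ^ j ℚ.* r ^ (M ℕ.* j) ℚ.* x ^ b
      ≡⟨ cong (λ z → e ^ j ℚ.* z ℚ.* x ^ b) (^-assocʳ r M j) ⟨
    e ^ j ℚ.* (r ^ M) ^ j ℚ.* x ^ b
      ≡⟨ cong (ℚ._* x ^ b) (^-distrib-* e (r ^ M) j) ⟨
    (e ℚ.* r ^ M) ^ j ℚ.* x ^ b
      <⟨ h ⟩
    x ^ a
      ≤⟨ ^-ratio a 0<x x≤ry ⟩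
    r ^ a ℚ.* y ^ a
      ≡⟨ ℚₚ.*-comm (r ^ a) (y ^ a) ⟩
    y ^ a ℚ.* r ^ a ∎)
  where
  open ℚₚ.≤-Reasoning
  open +-*-Solver
  0<r : 0ℚ ℚ.< r
  0<r = ℚₚ.<-≤-trans 0<1 1≤r

-- Here `M` bounds the absolute value of `s`: one of the two parts of the numerator is zero, so
-- their sum is its absolute value. A factor 3 between the bases then costs at most `3 ^ M`.
lower-^ℚ-transfer : ∀ {m m′ e} M s →
  1 ℕ.≤ m → 1 ℕ.≤ m′ → m ℕ.≤ 3 ℕ.* m′ → m′ ℕ.≤ 3 ℕ.* m → 0ℚ ℚ.< e →
  (↥ s) ⁺ ℕ.+ (↥ s) ⁻ ℕ.≤ M ℕ.* ↧ₙ s →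
  lower (m ^ℚ s) (e ℚ.* ι (+ 3) ^ M) → lower (m′ ^ℚ s) e
lower-^ℚ-transfer M s 1≤m 1≤m′ m≤3m′ m′≤3m 0<e ∣s∣≤M (inj₁ e3^M<0) =
  contradiction e3^M<0
    (≤⇒≯ (ℚₚ.<⇒≤ (*-pos 0<e (^-pos M (ι-mono-< {+ 0} {+ 3} (ℤ.+<+ (ℕ.s≤s ℕ.z≤n)))))))
lower-^ℚ-transfer {m} {m′} M s 1≤m 1≤m′ m≤3m′ m′≤3m 0<e ∣s∣≤M (inj₂ h) =
  inj₂ (scale-power-bound M (↧ₙ s) ((↥ s) ⁺) ((↥ s) ⁻)
    (ι-mono-≤ {+ 1} {+ 3} (ℤ.+≤+ (ℕ.s≤s ℕ.z≤n)))
    (ι-mono-< {+ 0} {+ m} (ℤ.+<+ 1≤m)) (ι-mono-< {+ 0} {+ m′} (ℤ.+<+ 1≤m′))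
    (ratio m m′ m≤3m′) (ratio m′ m m′≤3m) 0<e ∣s∣≤M h)
  where
  ratio : ∀ k l → k ℕ.≤ 3 ℕ.* l → ι (+ k) ℚ.≤ ι (+ 3) ℚ.* ι (+ l)
  ratio k l k≤3l rewrite ι-* (+ 3) (+ l) | sym (ℤₚ.pos-* 3 l) =
    ι-mono-≤ {+ k} {+ (3 ℕ.* l)} (ℤ.+≤+ k≤3l)

-- Since `s ≤ - (1 + M)` and `m ≥ 1`, passing to the exponent `- (1 + M)` only raises the power. The
-- number to keep below 1 is `c * m ^ (1 + M)`, and its `j`-th power is at most
-- `c ^ j * m ^ (1 + k) < 1`.
lower-^ℚ-raise : ∀ {m c} M k s → 1 ℕ.≤ m → 0ℚ ℚ.< c →
  ↥ s ≡ -[1+ k ] → suc M ℕ.* ↧ₙ s ℕ.≤ suc k →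
  lower (m ^ℚ s) c → lower (m ^ℚ Literals.fromℤ (-[1+ M ])) c
lower-^ℚ-raise M k s 1≤m 0<c eq Mj≤k (inj₁ c<0) = contradiction c<0 (≤⇒≯ (ℚₚ.<⇒≤ 0<c))
lower-^ℚ-raise {m} {c} M k s 1≤m 0<c eq Mj≤k (inj₂ h) rewrite eq =
  inj₂ (subst (λ z → z ℚ.* ι (+ m) ^ suc M ℚ.< 1ℚ) (sym (ℚₚ.*-identityʳ c))
    (x^n<1⇒x<1 j (begin-strict
      (c ℚ.* ι (+ m) ^ suc M) ^ j            ≡⟨ ^-distrib-* c _ j ⟩
      c ^ j ℚ.* (ι (+ m) ^ suc M) ^ j        ≡⟨ cong (c ^ j ℚ.*_) (^-assocʳ (ι (+ m)) (suc M) j) ⟩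
      c ^ j ℚ.* ι (+ m) ^ (suc M ℕ.* j)      ≤⟨ *-monoˡ-≤ (ℚₚ.<⇒≤ (^-pos j 0<c))
                                                 (^-monoʳ-≤ (ι-mono-≤ {+ 1} {+ m} (ℤ.+≤+ 1≤m)) Mj≤k) ⟩
      c ^ j ℚ.* ι (+ m) ^ suc k              <⟨ h ⟩
      1ℚ                                     ∎)))
  where
  open ℚₚ.≤-Reasoning
  j = ↧ₙ s

-- Dedekind cuts and transfer of approximations

p<p+q : ∀ p {q} → 0ℚ ℚ.< q → p ℚ.< p ℚ.+ q
p<p+q p {q} 0<q = subst (ℚ._< p ℚ.+ q) (ℚₚ.+-identityʳ p) (ℚₚ.+-monoʳ-< p 0<q)

p-q<p : ∀ p {q} → 0ℚ ℚ.< q → p ℚ.- q ℚ.< p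
p-q<p p {q} 0<q =
  subst (p ℚ.- q ℚ.<_) (ℚₚ.+-identityʳ p) (ℚₚ.+-monoʳ-< p (ℚₚ.neg-antimono-< 0<q))

fromℚ-isDedekind : ∀ r → IsDedekind (fromℚ r)
fromℚ-isDedekind r = record
  { lower-inhabited = r ℚ.- 1ℚ , p-q<p r 0<1
  ; upper-inhabited = r ℚ.+ 1ℚ , p<p+q r 0<1
  ; lower-closed    = ℚₚ.<-trans
  ; upper-closed    = λ a<b r<a → ℚₚ.<-trans r<a a<b
  ; lower-open      = λ a<r → let b , a<b , b<r = ℚₚ.<-dense a<r in b , a<b , b<r
  ; upper-open      = λ r<b → let a , r<a , a<b = ℚₚ.<-dense r<b in a , a<b , r<a
  ; disjoint        = ℚₚ.<-asym
  ; located         = located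
  }
  where
  located : ∀ {a b} → a ℚ.< b → a ℚ.< r ⊎ r ℚ.< b
  located {a} a<b with a ℚ.<? r
  ... | yes a<r = inj₁ a<r
  ... | no  a≮r = inj₂ (ℚₚ.≤-<-trans (ℚₚ.≮⇒≥ a≮r) a<b)

fromℚᴿ : ℚ → ℝ
fromℚᴿ r = record { cut = fromℚ r ; isDedekind = fromℚ-isDedekind r }

lower<upper : ∀ {x} → IsDedekind x → ∀ {a b} → lower x a → upper x b → a ℚ.< b
lower<upper dx {a} {b} la ub = ℚₚ.≰⇒> λ b≤a → case-≤ b≤a
  where
  open IsDedekind dx
  case-≤ : b ℚ.≤ a → _
  case-≤ b≤a with lower-open la
  ... | a′ , a<a′ , la′ = disjoint la′ (upper-closed (ℚₚ.≤-<-trans b≤a a<a′) ub)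

module _ (δ : ℝ) (0<δ : fromℤ (+ 0) <ᴿ cut δ) where

  private
    module δ = IsDedekind (isDedekind δ)
    exponent : Cut
    exponent = fromℚ 1ℚ -ᴿ cut δ

    d₀ : ℚ
    d₀ = proj₁ 0<δ

    0<d₀ : 0ℚ ℚ.< d₀
    0<d₀ = proj₁ (proj₂ 0<δ)

    lower-d₀ : lower (cut δ) d₀
    lower-d₀ = proj₂ (proj₂ 0<δ)

  exponent<1 : ∀ {s} → lower exponent s → s ℚ.< 1ℚ
  exponent<1 (a , b , a<1 , ub , s<a-b) =
    ℚₚ.<-trans s<a-b (ℚₚ.<-trans
      (p-q<p a (ℚₚ.<-trans 0<d₀ (lower<upper (isDedekind δ) lower-d₀ ub))) a<1)

  -- For `b` above `δ`, the integer `- (1 + ∣ ↥ b ∣)` lies below `- b`, hence below `1 - δ`. It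
  -- depends on `δ` alone and caps the exponents needed in the transfer between bases.
  exponent-lower-bound : Σ ℕ λ M → lower exponent (Literals.fromℤ (-[1+ M ]))
  exponent-lower-bound with δ.upper-inhabited
  ... | b , ub = ℤ.∣ ↥ b ∣ , 0ℚ , b , 0<1 , ub , (begin-strict
    Literals.fromℤ (-[1+ ℤ.∣ ↥ b ∣ ])    ≡⟨ ι≡fromℤ (-[1+ ℤ.∣ ↥ b ∣ ]) ⟨
    ℚ.- ι (+ suc ℤ.∣ ↥ b ∣)              <⟨ ℚₚ.neg-antimono-< (p<1+∣↥p∣ b) ⟩
    ℚ.- b                                ≡⟨ ℚₚ.+-identityˡ (ℚ.- b) ⟨
    0ℚ ℚ.- b                             ∎)
    where open ℚₚ.≤-Reasoning

  upper-exponent-1 : upper exponent 1ℚ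
  upper-exponent-1 with ℚₚ.<-dense (p<p+q 1ℚ 0<d₀)
  ... | a , 1<a , a<1+d₀ = a , d₀ , 1<a , lower-d₀ ,
    subst (a ℚ.- d₀ ℚ.<_) (solve 1 (λ d → con 1ℚ :+ d :- d := con 1ℚ) refl d₀)
      (ℚₚ.+-monoˡ-< (ℚ.- d₀) a<1+d₀)
    where open +-*-Solver

  -- The lower cut of a product asks for an upper bound of each factor. For the power, the exponent
  -- 1, which exceeds `1 - δ`, supplies one.
  upper-^ᴿ : ∀ m {d} → 0ℚ ℚ.< d → ι (+ m) ℚ.< d → upper (m ^ᴿ exponent) d
  upper-^ᴿ m {d} 0<d m<d = 1ℚ , upper-exponent-1 , 0<d ,
    subst₂ ℚ._<_ (sym (ℚₚ.*-identityʳ (ι (+ m))))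
      (sym (trans (ℚₚ.*-identityʳ (d ℚ.* 1ℚ)) (ℚₚ.*-identityʳ d))) m<d

  -- A rational exponent s < 1 - δ may be arbitrarily small, and m ^ s then does not control
  -- m′ ^ s uniformly; such an s is replaced by the fixed integer - (1 + M) < 1 - δ.
  lower-^ᴿ-transfer : ∀ {m m′ e} M → lower exponent (Literals.fromℤ (-[1+ M ])) →
    1 ℕ.≤ m → 1 ℕ.≤ m′ → m ℕ.≤ 3 ℕ.* m′ → m′ ℕ.≤ 3 ℕ.* m → 0ℚ ℚ.< e →
    lower (m ^ᴿ exponent) (e ℚ.* ι (+ 3) ^ suc M) → lower (m′ ^ᴿ exponent) e
  -- A nonnegative `s` is below 1, hence within the bound `1 + M`, and can be kept.
  lower-^ᴿ-transfer M l-M 1≤m 1≤m′ m≤3m′ m′≤3m 0<e (s@(ℚ.mkℚ (+ k) d _) , ls , h) =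
    s , ls , lower-^ℚ-transfer (suc M) s 1≤m 1≤m′ m≤3m′ m′≤3m 0<e (begin
      k ℕ.+ 0          ≡⟨ ℕₚ.+-identityʳ k ⟩
      k                ≤⟨ k≤d (exponent<1 ls) ⟩
      suc d            ≤⟨ ℕₚ.m≤n*m (suc d) (suc M) ⟩
      suc M ℕ.* suc d  ∎) h
    where
    open ℕₚ.≤-Reasoning
    k≤d : s ℚ.< 1ℚ → k ℕ.≤ suc d
    k≤d (*<* k<d) =
      ℕₚ.<⇒≤ (ℤₚ.drop‿+<+ (subst₂ ℤ._<_ (ℤₚ.*-identityʳ (+ k)) (ℤₚ.*-identityˡ (+ suc d)) k<d))
  lower-^ᴿ-transfer {m} {m′} {e} M l-M 1≤m 1≤m′ m≤3m′ m′≤3m 0<e (s@(ℚ.mkℚ (-[1+ k ]) d _) , ls , h)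
    with suc M ℕ.* suc d ℕ.≤? suc k
  ... | no  Md≰k = s , ls ,
    lower-^ℚ-transfer (suc M) s 1≤m 1≤m′ m≤3m′ m′≤3m 0<e (ℕₚ.<⇒≤ (ℕₚ.≰⇒> Md≰k)) h
  ... | yes Md≤k = -1-M , l-M ,
    lower-^ℚ-transfer (suc M) -1-M 1≤m 1≤m′ m≤3m′ m′≤3m 0<e
      (ℕₚ.≤-reflexive (sym (ℕₚ.*-identityʳ (suc M))))
      (lower-^ℚ-raise M k s 1≤m (*-pos 0<e (^-pos (suc M) (ι-mono-< {+ 0} {+ 3} (ℤ.+<+ (ℕ.s≤s ℕ.z≤n)))))
        refl Md≤k h)
    where
    -1-M : ℚ
    -1-M = Literals.fromℤ (-[1+ M ])

  -- The constant is `A + 1` with `A = g * B * 3 ^ (1 + M)` and `B` a rational above `C`. If the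
  -- hypothesis provides a rational `c` below `m ^ (1 - δ)`, then `e = c / 3 ^ (1 + M)` is below
  -- `m′ ^ (1 - δ)`, and the new error is less than `g * B * c = A * e`.
  IsApprox-transfer : (C : ℝ) → fromℤ (+ 0) <ᴿ cut C → (g : ℕ) → 1 ℕ.≤ g →
    Σ ℝ λ c → fromℤ (+ 0) <ᴿ cut c ×
      (∀ m m′ K K′ → 1 ℕ.≤ m → 1 ℕ.≤ m′ → m ℕ.≤ 3 ℕ.* m′ → m′ ℕ.≤ 3 ℕ.* m →
       ℤ.∣ + m′ ℤ.- K′ ∣ ℕ.≤ g ℕ.* ℤ.∣ + m ℤ.- K ∣ →
       IsApprox δ C m K → IsApprox δ c m′ K′)
  IsApprox-transfer C (z , 0<z , lz) g 1≤g
    with IsDedekind.upper-inhabited (isDedekind C) | exponent-lower-bound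
  ... | B , uB | M , l-M = fromℚᴿ (A ℚ.+ 1ℚ) , (A , 0<A , p<p+q A 0<1) , approx
    where
    T A : ℚ
    T = ι (+ 3) ^ suc M
    0<T : 0ℚ ℚ.< T
    0<T = ^-pos (suc M) (ι-mono-< {+ 0} {+ 3} (ℤ.+<+ (ℕ.s≤s ℕ.z≤n)))
    instance
      T-pos : ℚ.Positive T
      T-pos = ℚ.positive 0<T
      T-nonZero : ℚ.NonZero T
      T-nonZero = ℚₚ.pos⇒nonZero T
    A = ι (+ g) ℚ.* B ℚ.* T
    0<g : 0ℚ ℚ.< ι (+ g)
    0<g = ι-mono-< {+ 0} {+ g} (ℤ.+<+ 1≤g)
    0<A : 0ℚ ℚ.< A
    0<A = *-pos (*-pos 0<g (ℚₚ.<-trans 0<z (lower<upper (isDedekind C) lz uB))) 0<T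
    approx : ∀ m m′ K K′ → 1 ℕ.≤ m → 1 ℕ.≤ m′ → m ℕ.≤ 3 ℕ.* m′ → m′ ℕ.≤ 3 ℕ.* m →
      ℤ.∣ + m′ ℤ.- K′ ∣ ℕ.≤ g ℕ.* ℤ.∣ + m ℤ.- K ∣ →
      IsApprox δ C m K → IsApprox δ (fromℚᴿ (A ℚ.+ 1ℚ)) m′ K′
    approx m m′ K K′ 1≤m 1≤m′ m≤3m′ m′≤3m U′≤gU
      (x , U<x , a , b , c , d , la , ub , lc , _ , x<ac , _ , x<bc , _) =
      -- The rational `g * x` separates the error from the product. The constant is bracketed by `A`
      -- and `A + 2`, the power by `e` and `D`, and the least of the four corner products is
      -- `A * e`.
      ι (+ g) ℚ.* x , U′<gx , A , A ℚ.+ 1ℚ ℚ.+ 1ℚ , e , D ,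
      p<p+q A 0<1 , p<p+q (A ℚ.+ 1ℚ) 0<1 ,
      lower-^ᴿ-transfer M l-M 1≤m 1≤m′ m≤3m′ m′≤3m 0<e
        (subst (lower (m ^ᴿ exponent)) (sym eT≡c) lc) ,
      upper-^ᴿ m′ 0<D (p<p+q (ι (+ m′)) 0<e) ,
      gx<Ae , ℚₚ.<-trans gx<Ae Ae<AD , ℚₚ.<-trans gx<Ae (*-monoʳ-< 0<e A<A+2) ,
      ℚₚ.<-trans gx<Ae (ℚₚ.<-trans Ae<AD (*-monoʳ-< 0<D A<A+2))
      where
      open ℚₚ.≤-Reasoning
      open +-*-Solver
      e D : ℚ
      e = c ℚ.* ℚ.1/ T
      D = ι (+ m′) ℚ.+ e
      eT≡c : e ℚ.* T ≡ c
      eT≡c = trans (ℚₚ.*-assoc c (ℚ.1/ T) T)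
        (trans (cong (c ℚ.*_) (ℚₚ.*-inverseˡ T)) (ℚₚ.*-identityʳ c))
      0<x : 0ℚ ℚ.< x
      0<x = ℚₚ.≤-<-trans (ι-mono-≤ {+ 0} {+ ℤ.∣ + m ℤ.- K ∣} (ℤ.+≤+ ℕ.z≤n)) U<x
      0<b : 0ℚ ℚ.< b
      0<b = ℚₚ.<-trans 0<z (lower<upper (isDedekind C) lz ub)
      -- A lower cut also contains negative rationals; `0 < x < b * c` with `b > 0` excludes them
      -- here.
      0<c : 0ℚ ℚ.< c
      0<c = *-cancelˡ-< (ℚₚ.<⇒≤ 0<b)
        (subst (ℚ._< b ℚ.* c) (sym (ℚₚ.*-zeroʳ b)) (ℚₚ.<-trans 0<x x<bc))
      0<e : 0ℚ ℚ.< e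
      0<e = *-pos 0<c (ℚₚ.positive⁻¹ (ℚ.1/ T) ⦃ ℚₚ.1/pos⇒pos T ⦄)
      0<D : 0ℚ ℚ.< D
      0<D = ℚₚ.<-trans (ι-mono-< {+ 0} {+ m′} (ℤ.+<+ 1≤m′)) (p<p+q (ι (+ m′)) 0<e)
      e<D : e ℚ.< D
      e<D = subst (e ℚ.<_) (ℚₚ.+-comm e (ι (+ m′)))
        (p<p+q e (ι-mono-< {+ 0} {+ m′} (ℤ.+<+ 1≤m′)))
      Ae<AD : A ℚ.* e ℚ.< A ℚ.* D
      Ae<AD = *-monoˡ-< 0<A e<D
      A<A+2 : A ℚ.< A ℚ.+ 1ℚ ℚ.+ 1ℚ
      A<A+2 = ℚₚ.<-trans (p<p+q A 0<1) (p<p+q (A ℚ.+ 1ℚ) 0<1)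
      gx<Ae : ι (+ g) ℚ.* x ℚ.< A ℚ.* e
      gx<Ae = begin-strict
        ι (+ g) ℚ.* x              <⟨ *-monoˡ-< 0<g x<ac ⟩
        ι (+ g) ℚ.* (a ℚ.* c)      <⟨ *-monoˡ-< 0<g (*-monoʳ-< 0<c (lower<upper (isDedekind C) la uB)) ⟩
        ι (+ g) ℚ.* (B ℚ.* c)      ≡⟨ cong (λ y → ι (+ g) ℚ.* (B ℚ.* y)) eT≡c ⟨
        ι (+ g) ℚ.* (B ℚ.* (e ℚ.* T))
          ≡⟨ solve 4 (λ G B E T → G :* (B :* (E :* T)) := G :* B :* T :* E) refl (ι (+ g)) B e T ⟩
        A ℚ.* e                    ∎
      U′<gx : ι (+ ℤ.∣ + m′ ℤ.- K′ ∣) ℚ.< ι (+ g) ℚ.* x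
      U′<gx = begin-strict
        ι (+ ℤ.∣ + m′ ℤ.- K′ ∣)
          ≤⟨ ι-mono-≤ {+ ℤ.∣ + m′ ℤ.- K′ ∣} {+ (g ℕ.* ℤ.∣ + m ℤ.- K ∣)} (ℤ.+≤+ U′≤gU) ⟩
        ι (+ (g ℕ.* ℤ.∣ + m ℤ.- K ∣))
          ≡⟨ cong ι (ℤₚ.pos-* g ℤ.∣ + m ℤ.- K ∣) ⟩
        ι (+ g ℤ.* + ℤ.∣ + m ℤ.- K ∣)
          ≡⟨ ι-* (+ g) (+ ℤ.∣ + m ℤ.- K ∣) ⟨
        ι (+ g) ℚ.* ι (+ ℤ.∣ + m ℤ.- K ∣)
          <⟨ *-monoˡ-< 0<g U<x ⟩
        ι (+ g) ℚ.* x ∎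

-- The hypothesis K ≥ κ √n

p*↧p≡↥p : ∀ p → p ℚ.* ι (↧ p) ≡ ι (↥ p)
p*↧p≡↥p p@(ℚ.mkℚ u d _) rewrite ι≡fromℤ (+ suc d) | ι≡fromℤ u =
  ℚₚ.toℚᵘ-injective (ℚᵘₚ.≃-trans (ℚₚ.toℚᵘ-homo-* p (Literals.fromℤ (+ suc d)))
    (ℚᵘ.*≡* (trans (ℤₚ.*-identityʳ _) (cong (λ k → u ℤ.* + k) (sym (ℕₚ.*-identityʳ (suc d)))))))

-- Clearing the denominator of a > 2 in the hypothesis K ≥ a √n.
discriminant-bound : ∀ u v k n → 2 ℕ.* v ℕ.< u → u ℕ.* u ℕ.* n ℕ.≤ k ℕ.* k ℕ.* (v ℕ.* v) →
  let G = suc (4 ℕ.* (v ℕ.* v)) in k ℕ.* k ℕ.+ G ℕ.* (4 ℕ.* n) ℕ.≤ G ℕ.* (k ℕ.* k)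
discriminant-bound u v k n 2v<u u²n≤k²v² = begin
  k ℕ.* k ℕ.+ suc (4 ℕ.* (v ℕ.* v)) ℕ.* (4 ℕ.* n)
    ≤⟨ ℕₚ.+-monoʳ-≤ (k ℕ.* k) (ℕₚ.*-monoˡ-≤ (4 ℕ.* n) 4v²<u²) ⟩
  k ℕ.* k ℕ.+ u ℕ.* u ℕ.* (4 ℕ.* n)
    ≡⟨ lemma₁ (k ℕ.* k) (u ℕ.* u) n ⟩
  k ℕ.* k ℕ.+ 4 ℕ.* (u ℕ.* u ℕ.* n)
    ≤⟨ ℕₚ.+-monoʳ-≤ (k ℕ.* k) (ℕₚ.*-monoʳ-≤ 4 u²n≤k²v²) ⟩
  k ℕ.* k ℕ.+ 4 ℕ.* (k ℕ.* k ℕ.* (v ℕ.* v))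
    ≡⟨ lemma₂ (k ℕ.* k) (v ℕ.* v) ⟩
  suc (4 ℕ.* (v ℕ.* v)) ℕ.* (k ℕ.* k) ∎
  where
  open ℕₚ.≤-Reasoning
  lemma₁ : ∀ K U n → K ℕ.+ U ℕ.* (4 ℕ.* n) ≡ K ℕ.+ 4 ℕ.* (U ℕ.* n)
  lemma₁ = ℕ-Ring.solve-∀
  lemma₂ : ∀ K V → K ℕ.+ 4 ℕ.* (K ℕ.* V) ≡ suc (4 ℕ.* V) ℕ.* K
  lemma₂ = ℕ-Ring.solve-∀
  lemma₃ : ∀ v → 4 ℕ.* (v ℕ.* v) ≡ 2 ℕ.* v ℕ.* (2 ℕ.* v)
  lemma₃ = ℕ-Ring.solve-∀
  4v²<u² : suc (4 ℕ.* (v ℕ.* v)) ℕ.≤ u ℕ.* u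
  4v²<u² = subst (ℕ._< u ℕ.* u) (sym (lemma₃ v)) (ℕₚ.*-mono-< 2v<u 2v<u)

module _ (κ : ℝ) {n : ℕ} {K : ℤ} (1<n : 1 ℕ.< n) (κ√n≤K : cut κ *ᴿ (√ n) ≤ᴿ fromℤ K) where

  private
    1<ιn : 1ℚ ℚ.< ι (+ n)
    1<ιn = ι-mono-< {+ 1} {+ n} (ℤ.+<+ 1<n)

  -- The rationals `a < κ` and `r < √n` put `x` into the lower cut of `κ √n`, hence below `K`. The
  -- product cut also needs a rational above `√n`: `d = n + r` serves, because `d > n > 1` gives
  -- `d * d > d > n`.
  lower-product<K : ∀ {a r x} → 0ℚ ℚ.< a → lower (cut κ) a → 0ℚ ℚ.< r → r ℚ.* r ℚ.< ι (+ n) →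
    x ℚ.< a ℚ.* r → x ℚ.< ι K
  lower-product<K {a} {r} {x} 0<a la 0<r r²<n x<ar with IsDedekind.upper-inhabited (isDedekind κ)
  ... | b , ub = κ√n≤K x (a , b , r , d , la , ub , inj₂ r²<n , (0<d , n<d²) ,
    x<ar , x<ad , ℚₚ.<-trans x<ar (*-monoʳ-< 0<r a<b) , ℚₚ.<-trans x<ad (*-monoʳ-< 0<d a<b))
    where
    d : ℚ
    d = ι (+ n) ℚ.+ r
    n<d : ι (+ n) ℚ.< d
    n<d = p<p+q (ι (+ n)) 0<r
    1<d : 1ℚ ℚ.< d
    1<d = ℚₚ.<-trans 1<ιn n<d
    0<d : 0ℚ ℚ.< d
    0<d = ℚₚ.<-trans 0<1 1<d
    n<d² : ι (+ n) ℚ.< d ℚ.* d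
    n<d² = ℚₚ.<-trans n<d (subst (ℚ._< d ℚ.* d) (ℚₚ.*-identityˡ d) (*-monoʳ-< 0<d 1<d))
    r<d : r ℚ.< d
    r<d = subst (r ℚ.<_) (ℚₚ.+-comm r (ι (+ n))) (p<p+q r (ℚₚ.<-trans 0<1 1<ιn))
    a<b : a ℚ.< b
    a<b = lower<upper (isDedekind κ) la ub
    x<ad : x ℚ.< a ℚ.* d
    x<ad = ℚₚ.<-trans x<ar (*-monoˡ-< 0<a r<d)

  0<K : ∀ {a} → 0ℚ ℚ.< a → lower (cut κ) a → + 0 ℤ.< K
  0<K {a} 0<a la = ι-cancel-< {+ 0} {K}
    (lower-product<K 0<a la 0<1 1<ιn (subst (0ℚ ℚ.<_) (sym (ℚₚ.*-identityʳ a)) 0<a))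

  -- Otherwise `r = K / a` would satisfy `r * r < n`. Openness of the lower cut of `κ` gives
  -- `a′ > a`, still below `κ`, and then `K = a * r < a′ * r` would yield `K < K`.
  a²n≤K² : ∀ {a} → 0ℚ ℚ.< a → lower (cut κ) a → a ℚ.* a ℚ.* ι (+ n) ℚ.≤ ι K ℚ.* ι K
  a²n≤K² {a} 0<a la with IsDedekind.lower-open (isDedekind κ) la
  ... | a′ , a<a′ , la′ = ℚₚ.≮⇒≥ λ K²<a²n → ℚₚ.<-irrefl refl
    (lower-product<K (ℚₚ.<-trans 0<a a<a′) la′ 0<r
      (*-cancelˡ-< (ℚₚ.<⇒≤ (*-pos 0<a 0<a)) (subst (ℚ._< a ℚ.* a ℚ.* ι (+ n)) K²≡a²r² K²<a²n))
      (subst (ℚ._< a′ ℚ.* r) ar≡K (*-monoʳ-< 0<r a<a′)))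
    where
    instance
      a-pos : ℚ.Positive a
      a-pos = ℚ.positive 0<a
      a-nonZero : ℚ.NonZero a
      a-nonZero = ℚₚ.pos⇒nonZero a
    r : ℚ
    r = ℚ.1/ a ℚ.* ι K
    0<r : 0ℚ ℚ.< r
    0<r = *-pos (ℚₚ.positive⁻¹ (ℚ.1/ a) ⦃ ℚₚ.1/pos⇒pos a ⦄) (ι-mono-< {+ 0} {K} (0<K 0<a la))
    ar≡K : a ℚ.* r ≡ ι K
    ar≡K = trans (sym (ℚₚ.*-assoc a (ℚ.1/ a) (ι K)))
      (trans (cong (ℚ._* ι K) (ℚₚ.*-inverseʳ a)) (ℚₚ.*-identityˡ (ι K)))
    K²≡a²r² : ι K ℚ.* ι K ≡ a ℚ.* a ℚ.* (r ℚ.* r)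
    K²≡a²r² = trans (sym (cong₂ ℚ._*_ ar≡K ar≡K))
      (solve 2 (λ a r → a :* r :* (a :* r) := a :* a :* (r :* r)) refl a r)
      where open +-*-Solver

2↧<↥ : ∀ p → ι (+ 2) ℚ.< p → ∃[ u ] (↥ p ≡ + u × 2 ℕ.* ↧ₙ p ℕ.< u)
2↧<↥ (ℚ.mkℚ (+ u)    d _) (*<* h) =
  u , refl , ℤₚ.drop‿+<+ (subst (+ (2 ℕ.* suc d) ℤ.<_) (ℤₚ.*-identityʳ (+ u)) h)

rational-gap : ∀ {a K} n u v → 2 ℕ.* v ℕ.< u → a ℚ.* ι (+ v) ≡ ι (+ u) → + 0 ℤ.< K →
  a ℚ.* a ℚ.* ι (+ n) ℚ.≤ ι K ℚ.* ι K →
  let G = suc (4 ℕ.* (v ℕ.* v)) in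
  ∃[ k ] (K ≡ + k × 0 ℕ.< k × k ℕ.* k ℕ.+ G ℕ.* (4 ℕ.* n) ℕ.≤ G ℕ.* (k ℕ.* k))
rational-gap {a} {+ k} n u v 2v<u av≡u (ℤ.+<+ 0<k) a²n≤k² =
  k , refl , 0<k , discriminant-bound u v k n 2v<u
  (ℤₚ.drop‿+≤+ (ι-cancel-≤ {+ (u ℕ.* u ℕ.* n)} {+ (k ℕ.* k ℕ.* (v ℕ.* v))} (begin
    ι (+ (u ℕ.* u ℕ.* n))                        ≡⟨ ι-ℕ* (u ℕ.* u) n ⟨
    ι (+ (u ℕ.* u)) ℚ.* ι (+ n)                  ≡⟨ cong (ℚ._* ι (+ n)) (ι-ℕ* u u) ⟨
    ι (+ u) ℚ.* ι (+ u) ℚ.* ι (+ n)              ≡⟨ cong (λ x → x ℚ.* x ℚ.* ι (+ n)) av≡u ⟨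
    a ℚ.* ι (+ v) ℚ.* (a ℚ.* ι (+ v)) ℚ.* ι (+ n)
      ≡⟨ solve 3 (λ a v n → a :* v :* (a :* v) :* n := a :* a :* n :* (v :* v)) refl
           a (ι (+ v)) (ι (+ n)) ⟩
    a ℚ.* a ℚ.* ι (+ n) ℚ.* (ι (+ v) ℚ.* ι (+ v))
      ≡⟨ cong (a ℚ.* a ℚ.* ι (+ n) ℚ.*_) (ι-ℕ* v v) ⟩
    a ℚ.* a ℚ.* ι (+ n) ℚ.* ι (+ (v ℕ.* v))
      ≤⟨ *-monoʳ-≤ (ι-mono-≤ {+ 0} {+ (v ℕ.* v)} (ℤ.+≤+ ℕ.z≤n)) a²n≤k² ⟩
    ι (+ k) ℚ.* ι (+ k) ℚ.* ι (+ (v ℕ.* v))      ≡⟨ cong (ℚ._* ι (+ (v ℕ.* v))) (ι-ℕ* k k) ⟩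
    ι (+ (k ℕ.* k)) ℚ.* ι (+ (v ℕ.* v))          ≡⟨ ι-ℕ* (k ℕ.* k) (v ℕ.* v) ⟩
    ι (+ (k ℕ.* k ℕ.* (v ℕ.* v)))                ∎)))
  where
  open ℚₚ.≤-Reasoning
  open +-*-Solver
  ι-ℕ* : ∀ i j → ι (+ i) ℚ.* ι (+ j) ≡ ι (+ (i ℕ.* j))
  ι-ℕ* i j = trans (ι-* (+ i) (+ j)) (cong ι (sym (ℤₚ.pos-* i j)))

-- For a rational `a = u / v` strictly between 2 and `κ`, the integrality of `u` and `v` gives
-- `u² ≥ 4 v² + 1`, which turns `K² ≥ a² n` into `K² - 4 n ≥ K² / G` with `G = 4 v² + 1`. The
-- inequality is stated without subtraction or division so that it lives in `ℕ`.
κ-gap : (κ : ℝ) → fromℤ (+ 2) <ᴿ cut κ →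
  Σ ℕ λ G → ∀ {n K} → 1 ℕ.< n → cut κ *ᴿ (√ n) ≤ᴿ fromℤ K →
    ∃[ k ] (K ≡ + k × 0 ℕ.< k × k ℕ.* k ℕ.+ G ℕ.* (4 ℕ.* n) ℕ.≤ G ℕ.* (k ℕ.* k))
κ-gap κ (a , 2<a , la) with 2↧<↥ a 2<a
... | u , ↥a≡u , 2v<u = suc (4 ℕ.* (↧ₙ a ℕ.* ↧ₙ a)) , λ {n} {K} 1<n κ√n≤K →
  rational-gap {a} {K} n u (↧ₙ a) 2v<u (trans (p*↧p≡↥p a) (cong ι ↥a≡u))
    (0<K κ {K = K} 1<n κ√n≤K 0<a la) (a²n≤K² κ {K = K} 1<n κ√n≤K 0<a la)
  where
  0<a : 0ℚ ℚ.< a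
  0<a = ℚₚ.<-trans (ι-mono-< {+ 0} {+ 2} (ℤ.+<+ (ℕ.s≤s ℕ.z≤n))) 2<a

-- Error analysis over the integers

square-cancel-< : ∀ {m n} → m ℕ.* m ℕ.< n ℕ.* n → m ℕ.< n
square-cancel-< m²<n² = ℕₚ.≰⇒> λ n≤m → ℕₚ.<⇒≱ m²<n² (ℕₚ.*-mono-≤ n≤m n≤m)

square-cancel-≤ : ∀ {m n} → m ℕ.* m ℕ.≤ n ℕ.* n → m ℕ.≤ n
square-cancel-≤ m²≤n² = ℕₚ.≮⇒≥ λ n<m → ℕₚ.<⇒≱ (ℕₚ.*-mono-< n<m n<m) m²≤n²

gap⇒4n<k² : ∀ G k n → 1 ℕ.≤ k → k ℕ.* k ℕ.+ G ℕ.* (4 ℕ.* n) ℕ.≤ G ℕ.* (k ℕ.* k) → 4 ℕ.* n ℕ.< k ℕ.* k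
gap⇒4n<k² G k n 1≤k gap = ℕₚ.*-cancelˡ-< G _ _ (ℕₚ.<-≤-trans (ℕₚ.m<n+m _ (ℕₚ.*-mono-< 1≤k 1≤k)) gap)

-- The larger prime is written `q + d`, and `f` stands for `⌊√(k² - 4 n)⌋` through two inequalities
-- free of truncated subtraction.
module FactorError
  (q d k f G : ℕ) (1≤d : 1 ℕ.≤ d) (d≤q : d ℕ.≤ q) (1≤k : 1 ℕ.≤ k)
  (gap : k ℕ.* k ℕ.+ G ℕ.* (4 ℕ.* ((q ℕ.+ d) ℕ.* q)) ℕ.≤ G ℕ.* (k ℕ.* k))
  (f-low : f ℕ.* f ℕ.+ 4 ℕ.* ((q ℕ.+ d) ℕ.* q) ℕ.≤ k ℕ.* k)
  (f-high : k ℕ.* k ℕ.< suc f ℕ.* suc f ℕ.+ 4 ℕ.* ((q ℕ.+ d) ℕ.* q))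
  where

  open ℕₚ.≤-Reasoning

  p n s u Δ : ℕ
  p = q ℕ.+ d
  n = p ℕ.* q
  s = p ℕ.+ q
  u = ℤ.∣ + s ℤ.- + k ∣
  Δ = ℤ.∣ + d ℤ.- + f ∣

  pₐ : ℤ
  pₐ = (+ k ℤ.+ + f) ℤ./ℕ 2

  2q<k : 2 ℕ.* q ℕ.< k
  2q<k = square-cancel-< (begin-strict
    2 ℕ.* q ℕ.* (2 ℕ.* q)   ≡⟨ ℕ-Ring.solve (q List.∷ List.[]) ⟩
    4 ℕ.* (q ℕ.* q)         ≤⟨ ℕₚ.*-monoʳ-≤ 4 (ℕₚ.*-monoˡ-≤ q (ℕₚ.m≤m+n q d)) ⟩
    4 ℕ.* n                 <⟨ gap⇒4n<k² G k n 1≤k gap ⟩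
    k ℕ.* k                 ∎)

  s+k≤3k : s ℕ.+ k ℕ.≤ 3 ℕ.* k
  s+k≤3k = begin
    q ℕ.+ d ℕ.+ q ℕ.+ k
      ≤⟨ ℕₚ.+-monoˡ-≤ k (ℕₚ.+-monoˡ-≤ q (ℕₚ.+-monoʳ-≤ q (ℕₚ.≤-trans d≤q (ℕₚ.m≤m+n q q)))) ⟩
    q ℕ.+ (q ℕ.+ q) ℕ.+ q ℕ.+ k ≡⟨ ℕ-Ring.solve (q List.∷ k List.∷ List.[]) ⟩
    2 ℕ.* (2 ℕ.* q) ℕ.+ k     ≤⟨ ℕₚ.+-monoˡ-≤ k (ℕₚ.*-monoʳ-≤ 2 (ℕₚ.<⇒≤ 2q<k)) ⟩
    2 ℕ.* k ℕ.+ k             ≡⟨ ℕ-Ring.solve (k List.∷ List.[]) ⟩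
    3 ℕ.* k                   ∎

  -- The hypothesis `gap` reads `k² ≤ G (k² - 4 n)`, and the right side is at most `G (1 + f)²`.
  -- Weakening `G` to `G²` makes this a comparison of squares.
  k≤G[1+f] : k ℕ.≤ G ℕ.* suc f
  k≤G[1+f] = square-cancel-≤ (begin
    k ℕ.* k                            ≤⟨ ℕₚ.+-cancelʳ-≤ (G ℕ.* (4 ℕ.* n)) _ _ (begin
      k ℕ.* k ℕ.+ G ℕ.* (4 ℕ.* n)        ≤⟨ gap ⟩
      G ℕ.* (k ℕ.* k)                    ≤⟨ ℕₚ.*-monoʳ-≤ G (ℕₚ.<⇒≤ f-high) ⟩
      G ℕ.* (suc f ℕ.* suc f ℕ.+ 4 ℕ.* n) ≡⟨ ℕₚ.*-distribˡ-+ G (suc f ℕ.* suc f) (4 ℕ.* n) ⟩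
      G ℕ.* (suc f ℕ.* suc f) ℕ.+ G ℕ.* (4 ℕ.* n) ∎) ⟩
    G ℕ.* (suc f ℕ.* suc f)            ≤⟨ ℕₚ.*-monoˡ-≤ (suc f ℕ.* suc f) (m≤m² G) ⟩
    G ℕ.* G ℕ.* (suc f ℕ.* suc f)      ≡⟨ square-* G (suc f) ⟩
    G ℕ.* suc f ℕ.* (G ℕ.* suc f)      ∎)
    where
    m≤m² : ∀ m → m ℕ.≤ m ℕ.* m
    m≤m² zero    = ℕ.z≤n
    m≤m² (suc m) = ℕₚ.m≤m*n (suc m) (suc m)
    square-* : ∀ a b → a ℕ.* a ℕ.* (b ℕ.* b) ≡ a ℕ.* b ℕ.* (a ℕ.* b)
    square-* = ℕ-Ring.solve-∀

  -- The rounding loss of the integer square root. It is at most `2 f` because `(1 + f)²` already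
  -- exceeds `k² - 4 n`.
  w : ℕ
  w = k ℕ.* k ℕ.∸ (f ℕ.* f ℕ.+ 4 ℕ.* n)

  k²≡f²+4n+w : k ℕ.* k ≡ f ℕ.* f ℕ.+ 4 ℕ.* n ℕ.+ w
  k²≡f²+4n+w = sym (ℕₚ.m+[n∸m]≡n f-low)

  w≤2f : w ℕ.≤ 2 ℕ.* f
  w≤2f = ℕ.s≤s⁻¹ (ℕₚ.+-cancelˡ-< (f ℕ.* f ℕ.+ 4 ℕ.* n) _ _ (begin-strict
    f ℕ.* f ℕ.+ 4 ℕ.* n ℕ.+ w                 ≡⟨ k²≡f²+4n+w ⟨
    k ℕ.* k                                   <⟨ f-high ⟩
    suc f ℕ.* suc f ℕ.+ 4 ℕ.* n               ≡⟨ expand f (4 ℕ.* n) ⟩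
    f ℕ.* f ℕ.+ 4 ℕ.* n ℕ.+ suc (2 ℕ.* f)     ∎))
    where
    expand : ∀ f m → suc f ℕ.* suc f ℕ.+ m ≡ f ℕ.* f ℕ.+ m ℕ.+ suc (2 ℕ.* f)
    expand = ℕ-Ring.solve-∀

  pos-4n : + (4 ℕ.* n) ≡ + 4 ℤ.* ((+ q ℤ.+ + d) ℤ.* + q)
  pos-4n = trans (ℤₚ.pos-* 4 n) (cong (+ 4 ℤ.*_) (ℤₚ.pos-* p q))

  -- Both `s² - d²` and `k² - f² - w` equal `4 n`.
  difference-of-squares :
    (+ d ℤ.- + f) ℤ.* (+ d ℤ.+ + f) ≡ (+ s ℤ.- + k) ℤ.* (+ s ℤ.+ + k) ℤ.+ + w
  difference-of-squares = trans (identity (+ q) (+ d) (+ k) (+ f))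
    (cong (λ x → (+ s ℤ.- + k) ℤ.* (+ s ℤ.+ + k) ℤ.+ x)
      (trans (cong (λ x → x ℤ.- (+ f ℤ.* + f ℤ.+ + 4 ℤ.* ((+ q ℤ.+ + d) ℤ.* + q))) K²≡)
        (cancel (+ f ℤ.* + f ℤ.+ + 4 ℤ.* ((+ q ℤ.+ + d) ℤ.* + q)) (+ w))))
    where
    identity : ∀ Q D K F → (D ℤ.- F) ℤ.* (D ℤ.+ F) ≡
      (Q ℤ.+ D ℤ.+ Q ℤ.- K) ℤ.* (Q ℤ.+ D ℤ.+ Q ℤ.+ K) ℤ.+
      (K ℤ.* K ℤ.- (F ℤ.* F ℤ.+ + 4 ℤ.* ((Q ℤ.+ D) ℤ.* Q)))
    identity = ℤ-Ring.solve-∀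
    cancel : ∀ x y → x ℤ.+ y ℤ.- x ≡ y
    cancel = ℤ-Ring.solve-∀
    K²≡ : + k ℤ.* + k ≡ + f ℤ.* + f ℤ.+ + 4 ℤ.* ((+ q ℤ.+ + d) ℤ.* + q) ℤ.+ + w
    K²≡ = trans (sym (ℤₚ.pos-* k k)) (trans (cong +_ k²≡f²+4n+w)
      (cong₂ (λ x y → x ℤ.+ y ℤ.+ + w) (ℤₚ.pos-* f f) pos-4n))

  -- Divide `difference-of-squares` by `d + f`, using `s + k ≤ 3 k ≤ 3 G (1 + f)` and `w ≤ 2 f`. The
  -- hypothesis `1 ≤ d` makes the divisor positive and lets `d + f` replace `1 + f`.
  Δ≤ : Δ ℕ.≤ 3 ℕ.* G ℕ.* u ℕ.+ 2
  Δ≤ = ℕₚ.*-cancelʳ-≤ Δ _ (d ℕ.+ f) ⦃ ℕ.>-nonZero 1≤d+f ⦄ (begin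
    Δ ℕ.* (d ℕ.+ f)                               ≡⟨ ℤₚ.abs-* (+ d ℤ.- + f) (+ d ℤ.+ + f) ⟨
    ℤ.∣ (+ d ℤ.- + f) ℤ.* (+ d ℤ.+ + f) ∣         ≡⟨ cong ℤ.∣_∣ difference-of-squares ⟩
    ℤ.∣ (+ s ℤ.- + k) ℤ.* (+ s ℤ.+ + k) ℤ.+ + w ∣
      ≤⟨ ℤₚ.∣i+j∣≤∣i∣+∣j∣ ((+ s ℤ.- + k) ℤ.* (+ s ℤ.+ + k)) (+ w) ⟩
    ℤ.∣ (+ s ℤ.- + k) ℤ.* (+ s ℤ.+ + k) ∣ ℕ.+ w
      ≡⟨ cong (ℕ._+ w) (ℤₚ.abs-* (+ s ℤ.- + k) (+ s ℤ.+ + k)) ⟩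
    u ℕ.* (s ℕ.+ k) ℕ.+ w
      ≤⟨ ℕₚ.+-mono-≤ (ℕₚ.*-monoʳ-≤ u s+k≤3G[d+f]) (ℕₚ.≤-trans w≤2f (ℕₚ.*-monoʳ-≤ 2 (ℕₚ.m≤n+m f d))) ⟩
    u ℕ.* (3 ℕ.* (G ℕ.* (d ℕ.+ f))) ℕ.+ 2 ℕ.* (d ℕ.+ f) ≡⟨ collect u G (d ℕ.+ f) ⟩
    (3 ℕ.* G ℕ.* u ℕ.+ 2) ℕ.* (d ℕ.+ f)           ∎)
    where
    1≤d+f : 1 ℕ.≤ d ℕ.+ f
    1≤d+f = ℕₚ.≤-trans 1≤d (ℕₚ.m≤m+n d f)
    collect : ∀ u G x → u ℕ.* (3 ℕ.* (G ℕ.* x)) ℕ.+ 2 ℕ.* x ≡ (3 ℕ.* G ℕ.* u ℕ.+ 2) ℕ.* x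
    collect = ℕ-Ring.solve-∀
    s+k≤3G[d+f] : s ℕ.+ k ℕ.≤ 3 ℕ.* (G ℕ.* (d ℕ.+ f))
    s+k≤3G[d+f] = ℕₚ.≤-trans s+k≤3k (ℕₚ.*-monoʳ-≤ 3
      (ℕₚ.≤-trans k≤G[1+f] (ℕₚ.*-monoʳ-≤ G (ℕₚ.+-monoˡ-≤ f 1≤d))))

  -- Twice `p` is `s + d`, and twice `pₐ` is `k + f - r` with remainder `r ≤ 1`.
  2∣p-pₐ∣≤ : ℤ.∣ + p ℤ.- pₐ ∣ ℕ.* 2 ℕ.≤ u ℕ.+ Δ ℕ.+ 1
  2∣p-pₐ∣≤ = begin
    ℤ.∣ + p ℤ.- pₐ ∣ ℕ.* 2                              ≡⟨ ℤₚ.abs-* (+ p ℤ.- pₐ) (+ 2) ⟨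
    ℤ.∣ (+ p ℤ.- pₐ) ℤ.* + 2 ∣                          ≡⟨ cong ℤ.∣_∣ double ⟩
    ℤ.∣ (+ s ℤ.- + k) ℤ.+ (+ d ℤ.- + f) ℤ.+ + r ∣
      ≤⟨ ℤₚ.∣i+j∣≤∣i∣+∣j∣ ((+ s ℤ.- + k) ℤ.+ (+ d ℤ.- + f)) (+ r) ⟩
    ℤ.∣ (+ s ℤ.- + k) ℤ.+ (+ d ℤ.- + f) ∣ ℕ.+ r
      ≤⟨ ℕₚ.+-mono-≤ (ℤₚ.∣i+j∣≤∣i∣+∣j∣ (+ s ℤ.- + k) (+ d ℤ.- + f)) (ℕ.s≤s⁻¹ (ℤ.n%ℕd<d (+ k ℤ.+ + f) 2)) ⟩
    u ℕ.+ Δ ℕ.+ 1                                         ∎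
    where
    r : ℕ
    r = (+ k ℤ.+ + f) ℤ.%ℕ 2
    identity : ∀ Q D K F A → (Q ℤ.+ D ℤ.- A) ℤ.* + 2 ≡
      (Q ℤ.+ D ℤ.+ Q ℤ.- K) ℤ.+ (D ℤ.- F) ℤ.+ (K ℤ.+ F ℤ.- A ℤ.* + 2)
    identity = ℤ-Ring.solve-∀
    cancel : ∀ x y → x ℤ.+ y ℤ.- y ≡ x
    cancel = ℤ-Ring.solve-∀
    double : (+ p ℤ.- pₐ) ℤ.* + 2 ≡ (+ s ℤ.- + k) ℤ.+ (+ d ℤ.- + f) ℤ.+ + r
    double = trans (identity (+ q) (+ d) (+ k) (+ f) pₐ)
      (cong (λ x → (+ s ℤ.- + k) ℤ.+ (+ d ℤ.- + f) ℤ.+ x)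
        (trans (cong (λ x → x ℤ.- pₐ ℤ.* + 2) (ℤ.a≡a%ℕn+[a/ℕn]*n (+ k ℤ.+ + f) 2))
          (cancel (+ r) (pₐ ℤ.* + 2))))

  -- If `s = k`, then `k² - 4 n = d²` is a perfect square, so its integer square root `f` is `d`.
  u≡0⇒Δ≡0 : u ≡ 0 → Δ ≡ 0
  u≡0⇒Δ≡0 u≡0 = cong ℤ.∣_∣ (ℤₚ.i≡j⇒i-j≡0 {+ d} {+ f} (cong +_ (ℕₚ.≤-antisym d≤f f≤d)))
    where
    s≡k : s ≡ k
    s≡k = ℤₚ.+-injective (ℤₚ.i-j≡0⇒i≡j (+ s) (+ k) (ℤₚ.∣i∣≡0⇒i≡0 u≡0))
    complete-square : ∀ q d → (q ℕ.+ d ℕ.+ q) ℕ.* (q ℕ.+ d ℕ.+ q) ≡ d ℕ.* d ℕ.+ 4 ℕ.* ((q ℕ.+ d) ℕ.* q)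
    complete-square = ℕ-Ring.solve-∀
    k²≡ : k ℕ.* k ≡ d ℕ.* d ℕ.+ 4 ℕ.* n
    k²≡ = trans (sym (cong₂ ℕ._*_ s≡k s≡k)) (complete-square q d)
    f≤d : f ℕ.≤ d
    f≤d = square-cancel-≤ (ℕₚ.+-cancelʳ-≤ (4 ℕ.* n) _ _ (subst (f ℕ.* f ℕ.+ 4 ℕ.* n ℕ.≤_) k²≡ f-low))
    d≤f : d ℕ.≤ f
    d≤f = ℕ.s≤s⁻¹ (square-cancel-<
      (ℕₚ.+-cancelʳ-< (4 ℕ.* n) _ _ (subst (ℕ._< suc f ℕ.* suc f ℕ.+ 4 ℕ.* n) k²≡ f-high)))

  -- Rounding costs O(1), which is O(u) unless u = 0, and then the square root is exact.
  p-error : ℤ.∣ + p ℤ.- pₐ ∣ ℕ.≤ (4 ℕ.+ 3 ℕ.* G) ℕ.* u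
  p-error with u ℕₚ.≟ 0
  -- Twice the error is at most 1 here, so the error is 0.
  ... | yes u≡0 = ℕₚ.≤-trans (ℕₚ.≤-reflexive (ℕₚ.n<1⇒n≡0 (ℕₚ.*-cancelʳ-< 2 _ 1 (ℕ.s≤s (begin
      ℤ.∣ + p ℤ.- pₐ ∣ ℕ.* 2  ≤⟨ 2∣p-pₐ∣≤ ⟩
      u ℕ.+ Δ ℕ.+ 1             ≡⟨ cong₂ (λ x y → x ℕ.+ y ℕ.+ 1) u≡0 (u≡0⇒Δ≡0 u≡0) ⟩
      1                         ∎))))) ℕ.z≤n
  ... | no u≢0 = begin
      ℤ.∣ + p ℤ.- pₐ ∣                        ≤⟨ ℕₚ.m≤m*n _ 2 ⟩
      ℤ.∣ + p ℤ.- pₐ ∣ ℕ.* 2                  ≤⟨ 2∣p-pₐ∣≤ ⟩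
      u ℕ.+ Δ ℕ.+ 1                             ≤⟨ ℕₚ.+-monoˡ-≤ 1 (ℕₚ.+-monoʳ-≤ u Δ≤) ⟩
      u ℕ.+ (3 ℕ.* G ℕ.* u ℕ.+ 2) ℕ.+ 1         ≡⟨ collect₁ u G ⟩
      u ℕ.+ 3 ℕ.* G ℕ.* u ℕ.+ 3 ℕ.* 1
        ≤⟨ ℕₚ.+-monoʳ-≤ (u ℕ.+ 3 ℕ.* G ℕ.* u) (ℕₚ.*-monoʳ-≤ 3 (ℕₚ.n≢0⇒n>0 u≢0)) ⟩
      u ℕ.+ 3 ℕ.* G ℕ.* u ℕ.+ 3 ℕ.* u           ≡⟨ collect₂ u G ⟩
      (4 ℕ.+ 3 ℕ.* G) ℕ.* u                     ∎
    where
    collect₁ : ∀ u G → u ℕ.+ (3 ℕ.* G ℕ.* u ℕ.+ 2) ℕ.+ 1 ≡ u ℕ.+ 3 ℕ.* G ℕ.* u ℕ.+ 3 ℕ.* 1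
    collect₁ = ℕ-Ring.solve-∀
    collect₂ : ∀ u G → u ℕ.+ 3 ℕ.* G ℕ.* u ℕ.+ 3 ℕ.* u ≡ (4 ℕ.+ 3 ℕ.* G) ℕ.* u
    collect₂ = ℕ-Ring.solve-∀

  -- The two outputs add up to `k`, so the errors for `p` and `q` add up to `s - k`; this costs one
  -- further `u`.
  q-error : ℤ.∣ + q ℤ.- (+ k ℤ.- pₐ) ∣ ℕ.≤ (5 ℕ.+ 3 ℕ.* G) ℕ.* u
  q-error = begin
    ℤ.∣ + q ℤ.- (+ k ℤ.- pₐ) ∣                   ≡⟨ cong ℤ.∣_∣ (identity (+ q) (+ d) (+ k) pₐ) ⟩
    ℤ.∣ (+ s ℤ.- + k) ℤ.- (+ p ℤ.- pₐ) ∣         ≤⟨ ℤₚ.∣i-j∣≤∣i∣+∣j∣ (+ s ℤ.- + k) (+ p ℤ.- pₐ) ⟩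
    u ℕ.+ ℤ.∣ + p ℤ.- pₐ ∣                       ≤⟨ ℕₚ.+-monoʳ-≤ u p-error ⟩
    (5 ℕ.+ 3 ℕ.* G) ℕ.* u                          ∎
    where
    identity : ∀ Q D K A → Q ℤ.- (K ℤ.- A) ≡ (Q ℤ.+ D ℤ.+ Q ℤ.- K) ℤ.- (Q ℤ.+ D ℤ.- A)
    identity = ℤ-Ring.solve-∀

-- Bit lengths and programs

⌈log₂n⌉≤k⇒n≤2^k : ∀ k n → ⌈log₂ n ⌉ ℕ.≤ k → n ℕ.≤ 2 ℕ.^ k
⌈log₂n⌉≤k⇒n≤2^k zero    zero            _ = ℕ.z≤n
⌈log₂n⌉≤k⇒n≤2^k zero    (suc zero)      _ = ℕₚ.≤-refl
⌈log₂n⌉≤k⇒n≤2^k zero    (suc (suc n))   h =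
  contradiction (ℕₚ.≤-trans (⌈log₂⌉-mono-≤ {2} {suc (suc n)} (ℕ.s≤s (ℕ.s≤s ℕ.z≤n))) h) λ ()
⌈log₂n⌉≤k⇒n≤2^k (suc k) n               h = begin
  n                                   ≡⟨ ℕₚ.⌊n/2⌋+⌈n/2⌉≡n n ⟨
  ℕ.⌊ n /2⌋ ℕ.+ ℕ.⌈ n /2⌉
    ≤⟨ ℕₚ.+-mono-≤ (ℕₚ.≤-trans (ℕₚ.⌊n/2⌋≤⌈n/2⌉ n) ih) (ℕₚ.≤-trans ih (ℕₚ.m≤m+n _ 0)) ⟩
  2 ℕ.* 2 ℕ.^ k                       ∎
  where
  open ℕₚ.≤-Reasoning
  ih : ℕ.⌈ n /2⌉ ℕ.≤ 2 ℕ.^ k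
  ih = ⌈log₂n⌉≤k⇒n≤2^k k ℕ.⌈ n /2⌉
    (ℕₚ.≤-trans (ℕₚ.≤-reflexive (⌈log₂⌈n/2⌉⌉≡⌈log₂n⌉∸1 n)) (ℕₚ.∸-monoˡ-≤ 1 h))

∣z∣<2^k⇒bits≤1+k : ∀ k z → ℤ.∣ z ∣ ℕ.< 2 ℕ.^ k → bits z ℕ.≤ suc k
∣z∣<2^k⇒bits≤1+k k z z<2^k = ℕ.s≤s (ℕₚ.≤-trans (⌈log₂⌉-mono-≤ z<2^k) (ℕₚ.≤-reflexive (⌈log₂2^n⌉≡n k)))

∣z∣<2^[bits-1] : ∀ z → ℤ.∣ z ∣ ℕ.< 2 ℕ.^ ⌈log₂ suc ℤ.∣ z ∣ ⌉
∣z∣<2^[bits-1] z = ⌈log₂n⌉≤k⇒n≤2^k _ (suc ℤ.∣ z ∣) ℕₚ.≤-refl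

bits≤k⇒∣z∣<2^k : ∀ {k} z → bits z ℕ.≤ k → ℤ.∣ z ∣ ℕ.< 2 ℕ.^ k
bits≤k⇒∣z∣<2^k {k} z h =
  ⌈log₂n⌉≤k⇒n≤2^k k (suc ℤ.∣ z ∣) (ℕₚ.≤-trans (ℕₚ.n≤1+n _) h)

-- The product `(1 + ∣x∣) (1 + ∣y∣)` dominates `1 + ∣x + y∣`, and its logarithm splits into a sum.
bits-+ : ∀ x y → bits (x ℤ.+ y) ℕ.≤ bits x ℕ.+ bits y
bits-+ x y = ℕₚ.≤-trans (∣z∣<2^k⇒bits≤1+k (i ℕ.+ j) (x ℤ.+ y) (begin
  suc ℤ.∣ x ℤ.+ y ∣                  ≤⟨ ℕ.s≤s (ℤₚ.∣i+j∣≤∣i∣+∣j∣ x y) ⟩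
  suc (ℤ.∣ x ∣ ℕ.+ ℤ.∣ y ∣)          ≤⟨ ℕₚ.m≤m+n _ (ℤ.∣ x ∣ ℕ.* ℤ.∣ y ∣) ⟩
  suc (ℤ.∣ x ∣ ℕ.+ ℤ.∣ y ∣) ℕ.+ ℤ.∣ x ∣ ℕ.* ℤ.∣ y ∣ ≡⟨ factor ℤ.∣ x ∣ ℤ.∣ y ∣ ⟩
  suc ℤ.∣ x ∣ ℕ.* suc ℤ.∣ y ∣        ≤⟨ ℕₚ.*-mono-≤ (∣z∣<2^[bits-1] x) (∣z∣<2^[bits-1] y) ⟩
  2 ℕ.^ i ℕ.* 2 ℕ.^ j                ≡⟨ ℕₚ.^-distribˡ-+-* 2 i j ⟨
  2 ℕ.^ (i ℕ.+ j)                    ∎)) (ℕ.s≤s (ℕₚ.+-monoʳ-≤ i (ℕₚ.n≤1+n j)))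
  where
  open ℕₚ.≤-Reasoning
  i j : ℕ
  i = ⌈log₂ suc ℤ.∣ x ∣ ⌉
  j = ⌈log₂ suc ℤ.∣ y ∣ ⌉
  factor : ∀ a b → suc (a ℕ.+ b) ℕ.+ a ℕ.* b ≡ suc a ℕ.* suc b
  factor = ℕ-Ring.solve-∀

addition : PolyTimeAlgorithm 3 1
addition = record
  { w        = 0
  ; program  = 0F ≔ add 1F 2F
  ; out      = 0F ∷ []
  ; result   = λ { (_ ∷ x ∷ y ∷ []) → x ℤ.+ y ∷ [] }
  ; a        = 2
  ; d        = 1
  ; computes = λ { (z ∷ x ∷ y ∷ []) → _ , _ , ⇓assign , refl , cost z x y }
  }
  where
  open ℕₚ.≤-Reasoning
  cost : ∀ z x y →
    bits x ℕ.+ bits y ℕ.+ bits (x ℤ.+ y) ℕ.≤ 2 ℕ.* size (z ∷ x ∷ y ∷ []) ℕ.^ 1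
  cost z x y = begin
    bits x ℕ.+ bits y ℕ.+ bits (x ℤ.+ y)         ≤⟨ ℕₚ.+-monoʳ-≤ (bits x ℕ.+ bits y) (bits-+ x y) ⟩
    bits x ℕ.+ bits y ℕ.+ (bits x ℕ.+ bits y)    ≡⟨ double (bits x) (bits y) ⟩
    2 ℕ.* (bits x ℕ.+ (bits y ℕ.+ 0))            ≤⟨ ℕₚ.*-monoʳ-≤ 2 (ℕₚ.m≤n+m _ (bits z)) ⟩
    2 ℕ.* size (z ∷ x ∷ y ∷ [])
      ≡⟨ cong (2 ℕ.*_) (ℕₚ.^-identityʳ (size (z ∷ x ∷ y ∷ []))) ⟨
    2 ℕ.* size (z ∷ x ∷ y ∷ []) ℕ.^ 1            ∎
    where
    double : ∀ i j → i ℕ.+ j ℕ.+ (i ℕ.+ j) ≡ 2 ℕ.* (i ℕ.+ (j ℕ.+ 0))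
    double = ℕ-Ring.solve-∀

-- Registers: 0 n, 1 K, 2 N = K² - 4n, 3 l, 4 v, 5 the constant 1, 6 and 7 scratch and output,
-- 8 scratch. The loop bisects l ≤ ⌊√N⌋ ≤ l + v.

bisect : Cmd 9
bisect =
  6F ≔ half 4F ⨾
  7F ≔ add 3F 6F ⨾
  7F ≔ add 5F 7F ⨾
  8F ≔ mul 7F 7F ⨾
  8F ≔ sub 8F 2F ⨾
  -- Register `6F` holds `h = ⌊v / 2⌋` and `7F` the probe `m = l + h + 1`. If `m² > N`, the root is
  -- at most `l + h` and the width becomes `h`; otherwise it is at least `m`, and the width left is
  -- `v - h - 1`.
  ifPos 8F
    ⟨ 4F ≔ copy 6F
    ⟩⟨ 3F ≔ copy 7F ⨾ 4F ≔ sub 4F 6F ⨾ 4F ≔ sub 4F 5F ⟩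

split : Cmd 9
split =
  3F ≔ const (+ 4) ⨾
  2F ≔ mul 0F 3F ⨾
  3F ≔ mul 1F 1F ⨾
  2F ≔ sub 3F 2F ⨾
  3F ≔ const (+ 0) ⨾
  -- The initial width is `N` itself, since `⌊√N⌋ ≤ N`; for `N ≤ 0` the loop is not entered.
  4F ≔ copy 2F ⨾
  5F ≔ const (+ 1) ⨾
  whilePos 4F ⟨ bisect ⟩ ⨾
  6F ≔ add 1F 3F ⨾
  6F ≔ half 6F ⨾
  7F ≔ sub 1F 6F

-- Cost and correctness of the bisection loop

infixr 5 _⊕_
_⊕_ : ∀ {a b c d} → a ℕ.≤ b → c ℕ.≤ d → a ℕ.+ c ℕ.≤ b ℕ.+ d
_⊕_ = ℕₚ.+-mono-≤

∣i/ℕ2∣≤1+∣i∣ : ∀ i → ℤ.∣ i ℤ./ℕ 2 ∣ ℕ.≤ suc ℤ.∣ i ∣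
∣i/ℕ2∣≤1+∣i∣ i = begin
  ℤ.∣ i ℤ./ℕ 2 ∣              ≤⟨ ℕₚ.m≤m*n _ 2 ⟩
  ℤ.∣ i ℤ./ℕ 2 ∣ ℕ.* 2        ≡⟨ ℤₚ.abs-* (i ℤ./ℕ 2) (+ 2) ⟨
  ℤ.∣ i ℤ./ℕ 2 ℤ.* + 2 ∣      ≡⟨ cong ℤ.∣_∣ 2q≡i-r ⟩
  ℤ.∣ i ℤ.- + (i ℤ.%ℕ 2) ∣    ≤⟨ ℤₚ.∣i-j∣≤∣i∣+∣j∣ i (+ (i ℤ.%ℕ 2)) ⟩
  ℤ.∣ i ∣ ℕ.+ (i ℤ.%ℕ 2)      ≤⟨ ℕₚ.+-monoʳ-≤ ℤ.∣ i ∣ (ℕ.s≤s⁻¹ (ℤ.n%ℕd<d i 2)) ⟩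
  ℤ.∣ i ∣ ℕ.+ 1               ≡⟨ ℕₚ.+-comm ℤ.∣ i ∣ 1 ⟩
  suc ℤ.∣ i ∣                 ∎
  where
  open ℕₚ.≤-Reasoning
  cancel : ∀ x y → y ≡ x ℤ.+ y ℤ.- x
  cancel = ℤ-Ring.solve-∀
  2q≡i-r : i ℤ./ℕ 2 ℤ.* + 2 ≡ i ℤ.- + (i ℤ.%ℕ 2)
  2q≡i-r = trans (cancel (+ (i ℤ.%ℕ 2)) (i ℤ./ℕ 2 ℤ.* + 2))
    (cong (ℤ._- + (i ℤ.%ℕ 2)) (sym (ℤ.a≡a%ℕn+[a/ℕn]*n i 2)))

-- Here `X` will bound `N`, and with it `l`, `v` and the probe `m`. The largest intermediate value
-- is `m² - N`, hence the range `X² + X` whose bit lengths `L` must bound.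
module _ {X L : ℕ} (1≤X : 1 ℕ.≤ X) (fits : ∀ z → ℤ.∣ z ∣ ℕ.≤ X ℕ.* X ℕ.+ X → bits z ℕ.≤ L) where

  open ℕₚ.≤-Reasoning

  X≤X² : X ℕ.≤ X ℕ.* X
  X≤X² = ℕₚ.m≤m*n X X ⦃ ℕ.>-nonZero 1≤X ⦄

  fits-2X : ∀ z → ℤ.∣ z ∣ ℕ.≤ X ℕ.+ X → bits z ℕ.≤ L
  fits-2X z ∣z∣≤2X = fits z (ℕₚ.≤-trans ∣z∣≤2X (ℕₚ.+-monoˡ-≤ X X≤X²))

  fits-X : ∀ z → ℤ.∣ z ∣ ℕ.≤ X → bits z ℕ.≤ L
  fits-X z ∣z∣≤X = fits-2X z (ℕₚ.≤-trans ∣z∣≤X (ℕₚ.m≤m+n X X))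

  -- Induction on `k`, with invariant `l² ≤ N < (l + v + 1)²`; `l + v ≤ N` keeps the probe small.
  -- Either branch leaves a width of at most `⌊v / 2⌋`, so `v < 2 ^ k` allows at most `k` rounds of
  -- cost at most `24 * L`, followed by one last test. The equation `z ≡ + v` is an argument because
  -- one branch leaves the width as an integer difference.
  bisect-run : ∀ n K {N} → N ℕ.< X → ∀ k l v {z h m t} → z ≡ + v →
    v ℕ.< 2 ℕ.^ k → l ℕ.+ v ℕ.≤ N → l ℕ.* l ℕ.≤ N → N ℕ.< suc (l ℕ.+ v) ℕ.* suc (l ℕ.+ v) →
    ∃[ f ] ∃[ h′ ] ∃[ m′ ] ∃[ t′ ] ∃[ c ]
      (⟨ whilePos 4F ⟨ bisect ⟩ , n ∷ K ∷ + N ∷ + l ∷ z ∷ + 1 ∷ h ∷ m ∷ t ∷ [] ⟩⇓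
         (n ∷ K ∷ + N ∷ + f ∷ + 0 ∷ + 1 ∷ h′ ∷ m′ ∷ t′ ∷ []) [ c ] ×
       c ℕ.≤ k ℕ.* (24 ℕ.* L) ℕ.+ L ×
       f ℕ.≤ N × f ℕ.* f ℕ.≤ N × N ℕ.< suc f ℕ.* suc f)
  bisect-run n K {N} N<X k l zero refl v<2^k l+v≤N l²≤N N<r² =
    l , _ , _ , _ , _ , ⇓stop (ℤ.+≤+ ℕ.z≤n) ,
    ℕₚ.≤-trans (fits-X (+ 0) ℕ.z≤n) (ℕₚ.m≤n+m L (k ℕ.* (24 ℕ.* L))) ,
    ℕₚ.≤-trans (ℕₚ.m≤m+n l 0) l+v≤N , l²≤N ,
    subst (λ i → N ℕ.< suc i ℕ.* suc i) (ℕₚ.+-identityʳ l) N<r²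
  bisect-run n K N<X zero l (suc v) refl (ℕ.s≤s ()) l+v≤N l²≤N N<r²
  bisect-run n K {N} N<X (suc k) l v@(suc v-1) {h = h₀} {m₀} {t₀} refl v<2^k l+v≤N l²≤N N<r² = step
    where
    h m : ℕ
    h = v ℕ./ 2
    m = suc (l ℕ.+ h)

    h<v : h ℕ.< v
    h<v = ℕ.m/n<m v 2 (ℕ.s≤s (ℕ.s≤s ℕ.z≤n))
    m≤l+v : m ℕ.≤ l ℕ.+ v
    m≤l+v = subst (ℕ._≤ l ℕ.+ v) (ℕₚ.+-suc l h) (ℕₚ.+-monoʳ-≤ l h<v)
    h<2^k : h ℕ.< 2 ℕ.^ k
    h<2^k = ℕ.m<n*o⇒m/o<n (subst (v ℕ.<_) (ℕₚ.*-comm 2 (2 ℕ.^ k)) v<2^k)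
    v-h-1≤h : v ℕ.∸ suc h ℕ.≤ h
    v-h-1≤h = ℕₚ.m≤n+o⇒m∸n≤o v (suc h) (begin
      v                        ≡⟨ ℕ.m≡m%n+[m/n]*n v 2 ⟩
      v ℕ.% 2 ℕ.+ h ℕ.* 2      ≤⟨ ℕₚ.+-monoˡ-≤ (h ℕ.* 2) (ℕ.s≤s⁻¹ (ℕ.m%n<n v 2)) ⟩
      1 ℕ.+ h ℕ.* 2            ≡⟨ double h ⟩
      suc h ℕ.+ h              ∎)
      where
      double : ∀ h → 1 ℕ.+ h ℕ.* 2 ≡ suc h ℕ.+ h
      double = ℕ-Ring.solve-∀

    ≤N⇒≤X : ∀ {i} → i ℕ.≤ N → i ℕ.≤ X
    ≤N⇒≤X i≤N = ℕₚ.<⇒≤ (ℕₚ.≤-<-trans i≤N N<X)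
    v≤X : v ℕ.≤ X
    v≤X = ≤N⇒≤X (ℕₚ.≤-trans (ℕₚ.m≤n+m v l) l+v≤N)
    m≤X : m ℕ.≤ X
    m≤X = ≤N⇒≤X (ℕₚ.≤-trans m≤l+v l+v≤N)
    ∣m²∣≤X² : ℤ.∣ + m ℤ.* + m ∣ ℕ.≤ X ℕ.* X
    ∣m²∣≤X² = ℕₚ.≤-trans (ℕₚ.≤-reflexive (ℤₚ.abs-* (+ m) (+ m))) (ℕₚ.*-mono-≤ m≤X m≤X)

    bits-v : bits (+ v) ℕ.≤ L
    bits-v = fits-X (+ v) v≤X
    bits-h : bits (+ h) ℕ.≤ L
    bits-h = fits-X (+ h) (ℕₚ.≤-trans (ℕₚ.<⇒≤ h<v) v≤X)
    bits-l : bits (+ l) ℕ.≤ L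
    bits-l = fits-X (+ l) (≤N⇒≤X (ℕₚ.≤-trans (ℕₚ.m≤m+n l v) l+v≤N))
    bits-1 : bits (+ 1) ℕ.≤ L
    bits-1 = fits-X (+ 1) 1≤X
    bits-l+h : bits (+ (l ℕ.+ h)) ℕ.≤ L
    bits-l+h = fits-X (+ (l ℕ.+ h)) (ℕₚ.≤-trans (ℕₚ.n≤1+n _) m≤X)
    bits-m : bits (+ m) ℕ.≤ L
    bits-m = fits-X (+ m) m≤X
    bits-m² : bits (+ m ℤ.* + m) ℕ.≤ L
    bits-m² = fits (+ m ℤ.* + m) (ℕₚ.≤-trans ∣m²∣≤X² (ℕₚ.m≤m+n (X ℕ.* X) X))
    bits-N : bits (+ N) ℕ.≤ L
    bits-N = fits-X (+ N) (ℕₚ.<⇒≤ N<X)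
    bits-m²-N : bits (+ m ℤ.* + m ℤ.- + N) ℕ.≤ L
    bits-m²-N = fits (+ m ℤ.* + m ℤ.- + N)
      (ℕₚ.≤-trans (ℤₚ.∣i-j∣≤∣i∣+∣j∣ (+ m ℤ.* + m) (+ N)) (∣m²∣≤X² ⊕ ℕₚ.<⇒≤ N<X))
    bits-v-h : bits (+ v ℤ.- + h) ℕ.≤ L
    bits-v-h = fits-2X (+ v ℤ.- + h)
      (ℕₚ.≤-trans (ℤₚ.∣i-j∣≤∣i∣+∣j∣ (+ v) (+ h)) (v≤X ⊕ ℕₚ.≤-trans (ℕₚ.<⇒≤ h<v) v≤X))
    v-h-1≡ : + v ℤ.- + h ℤ.- + 1 ≡ + (v ℕ.∸ suc h)
    v-h-1≡ = trans (regroup (+ v) (+ h)) (trans (ℤₚ.[+m]-[+n]≡m⊖n v (suc h)) (ℤₚ.⊖-≥ h<v))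
      where
      regroup : ∀ V H → V ℤ.- H ℤ.- + 1 ≡ V ℤ.- (+ 1 ℤ.+ H)
      regroup = ℤ-Ring.solve-∀
    bits-v-h-1 : bits (+ v ℤ.- + h ℤ.- + 1) ℕ.≤ L
    bits-v-h-1 = subst (λ i → bits i ℕ.≤ L) (sym v-h-1≡)
      (fits-X (+ (v ℕ.∸ suc h)) (ℕₚ.≤-trans (ℕₚ.m∸n≤m v (suc h)) v≤X))

    m+v′≡l+v : m ℕ.+ (v ℕ.∸ suc h) ≡ l ℕ.+ v
    m+v′≡l+v = trans (cong (ℕ._+ (v ℕ.∸ suc h)) (sym (ℕₚ.+-suc l h)))
      (trans (ℕₚ.+-assoc l (suc h) _) (cong (l ℕ.+_) (ℕₚ.m+[n∸m]≡n h<v)))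

    -- The nested sum mirrors the cost that `⇓loop` assigns to one round: the loop test, five
    -- assignments and the test of the conditional take at most `16 * L`, the longer branch at most
    -- `8 * L`.
    prefix-cost : ∀ {branch rest} → branch ℕ.≤ 8 ℕ.* L → rest ℕ.≤ k ℕ.* (24 ℕ.* L) ℕ.+ L →
      bits (+ v) ℕ.+ ((bits (+ v) ℕ.+ bits (+ h)) ℕ.+
        ((bits (+ l) ℕ.+ bits (+ h) ℕ.+ bits (+ (l ℕ.+ h))) ℕ.+
        ((bits (+ 1) ℕ.+ bits (+ (l ℕ.+ h)) ℕ.+ bits (+ m)) ℕ.+
        ((bits (+ m) ℕ.+ bits (+ m) ℕ.+ bits (+ m ℤ.* + m)) ℕ.+
        ((bits (+ m ℤ.* + m) ℕ.+ bits (+ N) ℕ.+ bits (+ m ℤ.* + m ℤ.- + N)) ℕ.+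
        (bits (+ m ℤ.* + m ℤ.- + N) ℕ.+ branch))))) ℕ.+ rest)
      ℕ.≤ suc k ℕ.* (24 ℕ.* L) ℕ.+ L
    prefix-cost b≤ r≤ = ℕₚ.≤-trans
      (bits-v ⊕ ((bits-v ⊕ bits-h) ⊕
        (((bits-l ⊕ bits-h) ⊕ bits-l+h) ⊕
        (((bits-1 ⊕ bits-l+h) ⊕ bits-m) ⊕
        (((bits-m ⊕ bits-m) ⊕ bits-m²) ⊕
        (((bits-m² ⊕ bits-N) ⊕ bits-m²-N) ⊕
        (bits-m²-N ⊕ b≤)))))) ⊕ r≤)
      (ℕₚ.≤-reflexive (sum L (k ℕ.* (24 ℕ.* L))))
      where
      sum : ∀ L R → L ℕ.+ ((L ℕ.+ L) ℕ.+ ((L ℕ.+ L ℕ.+ L) ℕ.+ ((L ℕ.+ L ℕ.+ L) ℕ.+ ((L ℕ.+ L ℕ.+ L) ℕ.+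
        ((L ℕ.+ L ℕ.+ L) ℕ.+ (L ℕ.+ 8 ℕ.* L))))) ℕ.+ (R ℕ.+ L)) ≡ 24 ℕ.* L ℕ.+ R ℕ.+ L
      sum = ℕ-Ring.solve-∀

    step : ∃[ f ] ∃[ h′ ] ∃[ m′ ] ∃[ t′ ] ∃[ c ]
      (⟨ whilePos 4F ⟨ bisect ⟩ , n ∷ K ∷ + N ∷ + l ∷ + v ∷ + 1 ∷ h₀ ∷ m₀ ∷ t₀ ∷ [] ⟩⇓
         (n ∷ K ∷ + N ∷ + f ∷ + 0 ∷ + 1 ∷ h′ ∷ m′ ∷ t′ ∷ []) [ c ] ×
       c ℕ.≤ suc k ℕ.* (24 ℕ.* L) ℕ.+ L ×
       f ℕ.≤ N × f ℕ.* f ℕ.≤ N × N ℕ.< suc f ℕ.* suc f)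
    step with m ℕ.* m ℕ.≤? N
    ... | yes m²≤N
      with f , h′ , m′ , t′ , c , run , c≤ , spec ←
        bisect-run n K N<X k m (v ℕ.∸ suc h) {h = + h} {+ m} {+ m ℤ.* + m ℤ.- + N} v-h-1≡
          (ℕₚ.≤-<-trans v-h-1≤h h<2^k)
          (subst (ℕ._≤ N) (sym m+v′≡l+v) l+v≤N) m²≤N
          (subst (λ i → N ℕ.< suc i ℕ.* suc i) (sym m+v′≡l+v) N<r²) =
      f , h′ , m′ , t′ , _ ,
      ⇓loop (ℤ.+<+ (ℕ.s≤s ℕ.z≤n))
        (⇓seq ⇓assign (⇓seq ⇓assign (⇓seq ⇓assign (⇓seq ⇓assign (⇓seq ⇓assign
          (⇓else (ℤₚ.i≤j⇒i-j≤0 (subst (ℤ._≤ + N) (ℤₚ.pos-* m m) (ℤ.+≤+ m²≤N)))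
            (⇓seq ⇓assign (⇓seq ⇓assign ⇓assign)))))))) run ,
      prefix-cost (ℕₚ.≤-trans
        ((bits-m ⊕ bits-m) ⊕ ((bits-v ⊕ bits-h) ⊕ bits-v-h) ⊕ ((bits-v-h ⊕ bits-1) ⊕ bits-v-h-1))
        (ℕₚ.≤-reflexive (sum L))) c≤ , spec
      where
      sum : ∀ L → (L ℕ.+ L) ℕ.+ ((L ℕ.+ L ℕ.+ L) ℕ.+ (L ℕ.+ L ℕ.+ L)) ≡ 8 ℕ.* L
      sum = ℕ-Ring.solve-∀
    ... | no m²≰N
      with f , h′ , m′ , t′ , c , run , c≤ , spec ←
        bisect-run n K N<X k l h {h = + h} {+ m} {+ m ℤ.* + m ℤ.- + N} refl h<2^k
          (ℕₚ.≤-trans (ℕₚ.+-monoʳ-≤ l (ℕₚ.<⇒≤ h<v)) l+v≤N) l²≤N (ℕₚ.≰⇒> m²≰N) =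
      f , h′ , m′ , t′ , _ ,
      ⇓loop (ℤ.+<+ (ℕ.s≤s ℕ.z≤n))
        (⇓seq ⇓assign (⇓seq ⇓assign (⇓seq ⇓assign (⇓seq ⇓assign (⇓seq ⇓assign
          (⇓then 0<m²-N ⇓assign)))))) run ,
      prefix-cost (ℕₚ.≤-trans (bits-h ⊕ bits-h)
        (ℕₚ.+-monoʳ-≤ L (ℕₚ.m≤m+n L (6 ℕ.* L)))) c≤ , spec
      where
      0<m²-N : + 0 ℤ.< + m ℤ.* + m ℤ.- + N
      0<m²-N = subst (ℤ._< + m ℤ.* + m ℤ.- + N) (ℤₚ.+-inverseʳ (+ N))
        (ℤₚ.+-monoˡ-< (ℤ.- + N) (subst (+ N ℤ.<_) (ℤₚ.pos-* m m) (ℤ.+<+ (ℕₚ.≰⇒> m²≰N))))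

-- The program must halt on every input, including those with `K² < 4 n`. For negative `N` the
-- premise fails and `F` is unconstrained.
IsSqrtFloor : ℤ → ℤ → Set
IsSqrtFloor N F = ∀ {m} → N ≡ + m → ∃[ f ] (F ≡ + f × f ℕ.* f ℕ.≤ m × m ℕ.< suc f ℕ.* suc f)

module _ {X L : ℕ} (1≤X : 1 ℕ.≤ X) (X≤2^L : X ℕ.≤ 2 ℕ.^ L)
  (fits : ∀ z → ℤ.∣ z ∣ ℕ.≤ X ℕ.* X ℕ.+ X → bits z ℕ.≤ L) where

  -- The bisection starts from `l = 0` and `v = N`, where `N < (N + 1)²`, and `N < X ≤ 2 ^ L` limits
  -- it to `L` rounds. For negative `N` it stops at once with `F = 0`.
  sqrt-run : ∀ n K N h m t → ℤ.∣ N ∣ ℕ.< X →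
    ∃[ F ] ∃[ v ] ∃[ h′ ] ∃[ m′ ] ∃[ t′ ] ∃[ c ]
      (⟨ whilePos 4F ⟨ bisect ⟩ , n ∷ K ∷ N ∷ + 0 ∷ N ∷ + 1 ∷ h ∷ m ∷ t ∷ [] ⟩⇓
         (n ∷ K ∷ N ∷ F ∷ v ∷ + 1 ∷ h′ ∷ m′ ∷ t′ ∷ []) [ c ] ×
       c ℕ.≤ L ℕ.* (24 ℕ.* L) ℕ.+ L × ℤ.∣ F ∣ ℕ.≤ X × IsSqrtFloor N F)
  sqrt-run n K (+ N) h m t N<X
    with f , h′ , m′ , t′ , c , run , c≤ , f≤N , f²≤N , N<[1+f]² ←
      bisect-run 1≤X fits n K N<X L 0 N {h = h} {m} {t} refl (ℕₚ.<-≤-trans N<X X≤2^L) ℕₚ.≤-refl ℕ.z≤n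
        (ℕₚ.m≤m*n (suc N) (suc N)) =
    + f , _ , _ , _ , _ , _ , run , c≤ , ℕₚ.<⇒≤ (ℕₚ.≤-<-trans f≤N N<X) ,
    λ { refl → f , refl , f²≤N , N<[1+f]² }
  sqrt-run n K N@(-[1+ _ ]) h m t N<X =
    + 0 , _ , _ , _ , _ , _ , ⇓stop ℤ.-≤+ ,
    ℕₚ.≤-trans (fits-X 1≤X fits N (ℕₚ.<⇒≤ N<X)) (ℕₚ.m≤n+m L _) , ℕ.z≤n , λ ()

  -- The loop contributes at most `24 L² + L` to the cost, the assignments around it at most `22 L`.
  split-run : ∀ {T} n K → 24 ℕ.* (L ℕ.* L) ℕ.+ 23 ℕ.* L ℕ.≤ T → 
    ℤ.∣ n ∣ ℕ.≤ X → 3 ℕ.≤ X → ℤ.∣ n ℤ.* + 4 ∣ ℕ.≤ X → ℤ.∣ K ∣ ℕ.+ ℤ.∣ K ∣ ℕ.< X →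
    ℤ.∣ K ℤ.* K ∣ ℕ.≤ X → ℤ.∣ K ℤ.* K ℤ.- n ℤ.* + 4 ∣ ℕ.< X →
    ∃[ F ] ∃[ τ ] ∃[ c ]
      (⟨ split , n ∷ K ∷ replicate 7 (+ 0) ⟩⇓ τ [ c ] ×
       Vec.map (lookup τ) (6F ∷ 7F ∷ []) ≡ (K ℤ.+ F) ℤ./ℕ 2 ∷ K ℤ.- (K ℤ.+ F) ℤ./ℕ 2 ∷ [] ×
       c ℕ.≤ T × IsSqrtFloor (K ℤ.* K ℤ.- n ℤ.* + 4) F)
  split-run n K cost≤T n≤X 3≤X 4n≤X 2K<X K²≤X N<X
    with F , v , h′ , m′ , t′ , c , run , c≤ , F≤X , spec ←
      sqrt-run n K (K ℤ.* K ℤ.- n ℤ.* + 4) (+ 0) (+ 0) (+ 0) N<X =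
    F , _ , _ ,
    ⇓seq ⇓assign (⇓seq ⇓assign (⇓seq ⇓assign (⇓seq ⇓assign (⇓seq ⇓assign (⇓seq ⇓assign (⇓seq ⇓assign
      (⇓seq run (⇓seq ⇓assign (⇓seq ⇓assign ⇓assign))))))))) ,
    refl ,
    ℕₚ.≤-trans
      (b4 ⊕ ((bn ⊕ b4) ⊕ b4n) ⊕ ((bK ⊕ bK) ⊕ bK²) ⊕ ((bK² ⊕ b4n) ⊕ bN) ⊕ b0 ⊕ (bN ⊕ bN) ⊕ b1 ⊕
       c≤ ⊕ ((bK ⊕ bF) ⊕ bK+F) ⊕ (bK+F ⊕ bA) ⊕ ((bK ⊕ bA) ⊕ bK-A))
      (ℕₚ.≤-trans (ℕₚ.≤-reflexive (sum L)) cost≤T) ,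
    spec
    where
    N K+F A : ℤ
    N = K ℤ.* K ℤ.- n ℤ.* + 4
    K+F = K ℤ.+ F
    A = K+F ℤ./ℕ 2
    K≤X : ℤ.∣ K ∣ ℕ.≤ X
    K≤X = ℕₚ.<⇒≤ (ℕₚ.≤-<-trans (ℕₚ.m≤m+n ℤ.∣ K ∣ ℤ.∣ K ∣) 2K<X)
    ∣K+F∣≤ : ℤ.∣ K+F ∣ ℕ.≤ ℤ.∣ K ∣ ℕ.+ X
    ∣K+F∣≤ = ℕₚ.≤-trans (ℤₚ.∣i+j∣≤∣i∣+∣j∣ K F) (ℕₚ.+-monoʳ-≤ ℤ.∣ K ∣ F≤X)
    ∣A∣≤ : ℤ.∣ A ∣ ℕ.≤ suc (ℤ.∣ K ∣ ℕ.+ X)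
    ∣A∣≤ = ℕₚ.≤-trans (∣i/ℕ2∣≤1+∣i∣ K+F) (ℕ.s≤s ∣K+F∣≤)
    ∣K-A∣≤ : ℤ.∣ K ℤ.- A ∣ ℕ.≤ X ℕ.+ X
    ∣K-A∣≤ = begin
      ℤ.∣ K ℤ.- A ∣                           ≤⟨ ℤₚ.∣i-j∣≤∣i∣+∣j∣ K A ⟩
      ℤ.∣ K ∣ ℕ.+ ℤ.∣ A ∣                     ≤⟨ ℕₚ.+-monoʳ-≤ ℤ.∣ K ∣ ∣A∣≤ ⟩
      ℤ.∣ K ∣ ℕ.+ suc (ℤ.∣ K ∣ ℕ.+ X)         ≡⟨ regroup ℤ.∣ K ∣ X ⟩
      suc (ℤ.∣ K ∣ ℕ.+ ℤ.∣ K ∣) ℕ.+ X         ≤⟨ ℕₚ.+-monoˡ-≤ X 2K<X ⟩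
      X ℕ.+ X                                 ∎
      where
      open ℕₚ.≤-Reasoning
      regroup : ∀ k x → k ℕ.+ suc (k ℕ.+ x) ≡ suc (k ℕ.+ k) ℕ.+ x
      regroup = ℕ-Ring.solve-∀
    b0 : bits (+ 0) ℕ.≤ L
    b0 = fits-X 1≤X fits (+ 0) ℕ.z≤n
    b1 : bits (+ 1) ℕ.≤ L
    b1 = fits-X 1≤X fits (+ 1) 1≤X
    b4 : bits (+ 4) ℕ.≤ L
    b4 = fits-2X 1≤X fits (+ 4) (1≤X ⊕ 3≤X)
    bn : bits n ℕ.≤ L
    bn = fits-X 1≤X fits n n≤X
    b4n : bits (n ℤ.* + 4) ℕ.≤ L
    b4n = fits-X 1≤X fits (n ℤ.* + 4) 4n≤X
    bK : bits K ℕ.≤ L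
    bK = fits-X 1≤X fits K K≤X
    bK² : bits (K ℤ.* K) ℕ.≤ L
    bK² = fits-X 1≤X fits (K ℤ.* K) K²≤X
    bN : bits N ℕ.≤ L
    bN = fits-X 1≤X fits N (ℕₚ.<⇒≤ N<X)
    bF : bits F ℕ.≤ L
    bF = fits-X 1≤X fits F F≤X
    bK+F : bits K+F ℕ.≤ L
    bK+F = fits-2X 1≤X fits K+F (ℕₚ.≤-trans ∣K+F∣≤ (ℕₚ.+-monoˡ-≤ X K≤X))
    bA : bits A ℕ.≤ L
    bA = fits-2X 1≤X fits A (ℕₚ.≤-trans ∣A∣≤
      (ℕₚ.+-monoˡ-≤ X (ℕₚ.≤-<-trans (ℕₚ.m≤m+n ℤ.∣ K ∣ ℤ.∣ K ∣) 2K<X)))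
    bK-A : bits (K ℤ.- A) ℕ.≤ L
    bK-A = fits-2X 1≤X fits (K ℤ.- A) ∣K-A∣≤
    sum : ∀ L → L ℕ.+ ((L ℕ.+ L ℕ.+ L) ℕ.+ ((L ℕ.+ L ℕ.+ L) ℕ.+ ((L ℕ.+ L ℕ.+ L) ℕ.+ (L ℕ.+ ((L ℕ.+ L) ℕ.+ (L ℕ.+
      ((L ℕ.* (24 ℕ.* L) ℕ.+ L) ℕ.+ ((L ℕ.+ L ℕ.+ L) ℕ.+ ((L ℕ.+ L) ℕ.+ (L ℕ.+ L ℕ.+ L))))))))))
      ≡ 24 ℕ.* (L ℕ.* L) ℕ.+ 23 ℕ.* L
    sum = ℕ-Ring.solve-∀

-- The power `A = 2 ^ s` exceeds both inputs in absolute value. The choice `X = 3 A²` covers the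
-- discriminant, as `1 + b² + 4 a ≤ (1 + b)² + 2 (1 + a)²` for `a = ∣n∣`, `b = ∣K∣`. Then
-- `X² + X ≤ 12 A⁴ < 16 A⁴ = 2 ^ (4 s + 4)`, and `L` adds the sign bit.
module SplitBounds (n K : ℤ) where
  open ℕₚ.≤-Reasoning
  s A X L : ℕ
  s = size (n ∷ K ∷ [])
  A = 2 ℕ.^ s
  X = 3 ℕ.* (A ℕ.* A)
  L = suc (4 ℕ.* s ℕ.+ 4)
  n<A : ℤ.∣ n ∣ ℕ.< A
  n<A = bits≤k⇒∣z∣<2^k n (ℕₚ.m≤m+n (bits n) _)
  K<A : ℤ.∣ K ∣ ℕ.< A
  K<A = bits≤k⇒∣z∣<2^k K (ℕₚ.≤-trans (ℕₚ.m≤m+n (bits K) 0) (ℕₚ.m≤n+m _ (bits n)))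
  1≤A : 1 ℕ.≤ A
  1≤A = ℕₚ.≤-trans (ℕ.s≤s ℕ.z≤n) n<A
  A≤A² : A ℕ.≤ A ℕ.* A
  A≤A² = ℕₚ.m≤m*n A A ⦃ ℕ.>-nonZero 1≤A ⦄
  1≤A² : 1 ℕ.≤ A ℕ.* A
  1≤A² = ℕₚ.≤-trans 1≤A A≤A²
  3≤X : 3 ℕ.≤ X
  3≤X = ℕₚ.*-monoʳ-≤ 3 1≤A²
  1≤X : 1 ℕ.≤ X
  1≤X = ℕₚ.≤-trans (ℕ.s≤s ℕ.z≤n) 3≤X
  A≤X : A ℕ.≤ X
  A≤X = ℕₚ.≤-trans A≤A² (ℕₚ.m≤m+n (A ℕ.* A) _)
  n≤X : ℤ.∣ n ∣ ℕ.≤ X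
  n≤X = ℕₚ.<⇒≤ (ℕₚ.<-≤-trans n<A A≤X)
  2K<X : ℤ.∣ K ∣ ℕ.+ ℤ.∣ K ∣ ℕ.< X
  2K<X = ℕₚ.<-≤-trans (ℕₚ.+-mono-<-≤ K<A (ℕₚ.<⇒≤ K<A))
    (A≤A² ⊕ ℕₚ.≤-trans A≤A² (ℕₚ.m≤m+n (A ℕ.* A) _))
  K²+4n<X : ℤ.∣ K ℤ.* K ∣ ℕ.+ ℤ.∣ n ℤ.* + 4 ∣ ℕ.< X
  K²+4n<X = begin
    suc (ℤ.∣ K ℤ.* K ∣ ℕ.+ ℤ.∣ n ℤ.* + 4 ∣)
      ≡⟨ cong₂ (λ x y → suc (x ℕ.+ y)) (ℤₚ.abs-* K K) (ℤₚ.abs-* n (+ 4)) ⟩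
    suc (b ℕ.* b ℕ.+ a ℕ.* 4)
      ≤⟨ ℕₚ.m≤m+n _ (2 ℕ.* b ℕ.+ 2 ℕ.+ 2 ℕ.* (a ℕ.* a)) ⟩
    suc (b ℕ.* b ℕ.+ a ℕ.* 4) ℕ.+ (2 ℕ.* b ℕ.+ 2 ℕ.+ 2 ℕ.* (a ℕ.* a))
      ≡⟨ complete a b ⟩
    suc b ℕ.* suc b ℕ.+ 2 ℕ.* (suc a ℕ.* suc a)
      ≤⟨ ℕₚ.*-mono-≤ K<A K<A ⊕ ℕₚ.*-monoʳ-≤ 2 (ℕₚ.*-mono-≤ n<A n<A) ⟩
    X ∎
    where
    a b : ℕ
    a = ℤ.∣ n ∣
    b = ℤ.∣ K ∣
    complete : ∀ a b → suc (b ℕ.* b ℕ.+ a ℕ.* 4) ℕ.+ (2 ℕ.* b ℕ.+ 2 ℕ.+ 2 ℕ.* (a ℕ.* a)) ≡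
      suc b ℕ.* suc b ℕ.+ 2 ℕ.* (suc a ℕ.* suc a)
    complete = ℕ-Ring.solve-∀
  K²≤X : ℤ.∣ K ℤ.* K ∣ ℕ.≤ X
  K²≤X = ℕₚ.≤-trans (ℕₚ.m≤m+n _ _) (ℕₚ.<⇒≤ K²+4n<X)
  4n≤X : ℤ.∣ n ℤ.* + 4 ∣ ℕ.≤ X
  4n≤X = ℕₚ.≤-trans (ℕₚ.m≤n+m _ ℤ.∣ K ℤ.* K ∣) (ℕₚ.<⇒≤ K²+4n<X)
  N<X : ℤ.∣ K ℤ.* K ℤ.- n ℤ.* + 4 ∣ ℕ.< X
  N<X = ℕₚ.≤-<-trans (ℤₚ.∣i-j∣≤∣i∣+∣j∣ (K ℤ.* K) (n ℤ.* + 4)) K²+4n<X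
  X²+X<2^[4s+4] : X ℕ.* X ℕ.+ X ℕ.< 2 ℕ.^ (4 ℕ.* s ℕ.+ 4)
  X²+X<2^[4s+4] = begin-strict
    X ℕ.* X ℕ.+ 3 ℕ.* Y
      ≤⟨ ℕₚ.+-monoʳ-≤ (X ℕ.* X) (ℕₚ.*-monoʳ-≤ 3 (ℕₚ.m≤m*n Y Y ⦃ ℕ.>-nonZero 1≤A² ⦄)) ⟩
    X ℕ.* X ℕ.+ 3 ℕ.* (Y ℕ.* Y)
      <⟨ ℕₚ.m<m+n _ (ℕₚ.≤-trans (ℕₚ.*-mono-≤ 1≤A² 1≤A²) (ℕₚ.m≤m+n (Y ℕ.* Y) _)) ⟩
    X ℕ.* X ℕ.+ 3 ℕ.* (Y ℕ.* Y) ℕ.+ 4 ℕ.* (Y ℕ.* Y) ≡⟨ collect A ⟩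
    A ℕ.* (A ℕ.* (A ℕ.* (A ℕ.* 1))) ℕ.* 16         ≡⟨⟩
    (2 ℕ.^ s) ℕ.^ 4 ℕ.* 16               ≡⟨ cong (ℕ._* 16) (ℕₚ.^-*-assoc 2 s 4) ⟩
    2 ℕ.^ (s ℕ.* 4) ℕ.* 16               ≡⟨ cong (λ e → 2 ℕ.^ e ℕ.* 16) (ℕₚ.*-comm s 4) ⟩
    2 ℕ.^ (4 ℕ.* s) ℕ.* 2 ℕ.^ 4          ≡⟨ ℕₚ.^-distribˡ-+-* 2 (4 ℕ.* s) 4 ⟨
    2 ℕ.^ (4 ℕ.* s ℕ.+ 4)                ∎
    where
    Y : ℕ
    Y = A ℕ.* A
    collect : ∀ a → 3 ℕ.* (a ℕ.* a) ℕ.* (3 ℕ.* (a ℕ.* a)) ℕ.+ 3 ℕ.* (a ℕ.* a ℕ.* (a ℕ.* a)) ℕ.+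
      4 ℕ.* (a ℕ.* a ℕ.* (a ℕ.* a)) ≡
      a ℕ.* (a ℕ.* (a ℕ.* (a ℕ.* 1))) ℕ.* 16
    collect = ℕ-Ring.solve-∀
  X≤2^L : X ℕ.≤ 2 ℕ.^ L
  X≤2^L = ℕₚ.≤-trans (ℕₚ.m≤n+m X (X ℕ.* X)) (ℕₚ.≤-trans (ℕₚ.<⇒≤ X²+X<2^[4s+4]) (ℕₚ.m≤m+n _ _))
  fits : ∀ z → ℤ.∣ z ∣ ℕ.≤ X ℕ.* X ℕ.+ X → bits z ℕ.≤ L
  fits z h = ∣z∣<2^k⇒bits≤1+k (4 ℕ.* s ℕ.+ 4) z (ℕₚ.≤-<-trans h X²+X<2^[4s+4])
  -- The factor 47 is `24 + 23`, from `L ≤ L²`, and each 9 is from `L = 4 s + 5 ≤ 9 s`, where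
  -- `s ≥ 1` because every bit length counts a sign bit.
  cost≤ : 24 ℕ.* (L ℕ.* L) ℕ.+ 23 ℕ.* L ℕ.≤ 47 ℕ.* 9 ℕ.* 9 ℕ.* s ℕ.^ 2
  cost≤ = begin
    24 ℕ.* (L ℕ.* L) ℕ.+ 23 ℕ.* L
      ≤⟨ ℕₚ.+-monoʳ-≤ (24 ℕ.* (L ℕ.* L)) (ℕₚ.*-monoʳ-≤ 23 (ℕₚ.m≤m*n L L)) ⟩
    24 ℕ.* (L ℕ.* L) ℕ.+ 23 ℕ.* (L ℕ.* L)        ≡⟨ ℕₚ.*-distribʳ-+ (L ℕ.* L) 24 23 ⟨
    47 ℕ.* (L ℕ.* L)                             ≤⟨ ℕₚ.*-monoʳ-≤ 47 (ℕₚ.*-mono-≤ L≤9s L≤9s) ⟩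
    47 ℕ.* (9 ℕ.* s ℕ.* (9 ℕ.* s))               ≡⟨ collect 47 9 s ⟩
    47 ℕ.* 9 ℕ.* 9 ℕ.* (s ℕ.* (s ℕ.* 1))         ∎
    where
    collect : ∀ b c s → b ℕ.* (c ℕ.* s ℕ.* (c ℕ.* s)) ≡ b ℕ.* c ℕ.* c ℕ.* (s ℕ.* (s ℕ.* 1))
    collect = ℕ-Ring.solve-∀
    L≤9s : L ℕ.≤ 9 ℕ.* s
    L≤9s = begin
      suc (4 ℕ.* s ℕ.+ 4)       ≡⟨ ℕₚ.+-suc (4 ℕ.* s) 4 ⟨
      4 ℕ.* s ℕ.+ 5 ℕ.* 1       ≤⟨ ℕₚ.+-monoʳ-≤ (4 ℕ.* s) (ℕₚ.*-monoʳ-≤ 5 {1} {s} (ℕ.s≤s ℕ.z≤n)) ⟩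
      4 ℕ.* s ℕ.+ 5 ℕ.* s       ≡⟨ ℕₚ.*-distribʳ-+ s 4 5 ⟨
      9 ℕ.* s                   ∎

  execution : ∃[ F ] ∃[ τ ] ∃[ c ]
    (⟨ split , n ∷ K ∷ replicate 7 (+ 0) ⟩⇓ τ [ c ] ×
     Vec.map (lookup τ) (6F ∷ 7F ∷ []) ≡ (K ℤ.+ F) ℤ./ℕ 2 ∷ K ℤ.- (K ℤ.+ F) ℤ./ℕ 2 ∷ [] ×
     c ℕ.≤ 47 ℕ.* 9 ℕ.* 9 ℕ.* s ℕ.^ 2 × IsSqrtFloor (K ℤ.* K ℤ.- n ℤ.* + 4) F)
  execution = split-run 1≤X X≤2^L fits n K cost≤ n≤X 3≤X 4n≤X 2K<X K²≤X N<X

-- The outputs are defined from the root found by `SplitBounds.execution`, so the `IsSqrtFloor`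
-- property of that run applies to them directly.
splitting : PolyTimeAlgorithm 2 2
splitting = record
  { w        = 7
  ; program  = split
  ; out      = 6F ∷ 7F ∷ []
  ; result   = λ { (n ∷ K ∷ []) →
      let A = (K ℤ.+ proj₁ (SplitBounds.execution n K)) ℤ./ℕ 2 in A ∷ K ℤ.- A ∷ [] }
  ; a        = 47 ℕ.* 9 ℕ.* 9
  ; d        = 2
  ; computes = λ { (n ∷ K ∷ []) →
      let _ , τ , c , run , out≡ , c≤ , _ = SplitBounds.execution n K in τ , c , run , out≡ , c≤ }
  }

-- Accuracy of the outputs of both algorithms

discriminant≡ : ∀ k n → 4 ℕ.* n ℕ.≤ k ℕ.* k →
  + k ℤ.* + k ℤ.- + n ℤ.* + 4 ≡ + (k ℕ.* k ℕ.∸ 4 ℕ.* n)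
discriminant≡ k n 4n≤k² = trans
  (cong₂ ℤ._-_ (sym (ℤₚ.pos-* k k)) (trans (sym (ℤₚ.pos-* n 4)) (cong +_ (ℕₚ.*-comm n 4))))
  (trans (ℤₚ.[+m]-[+n]≡m⊖n (k ℕ.* k) (4 ℕ.* n)) (ℤₚ.⊖-≥ 4n≤k²))

-- The gap gives `4 n < k²`, so the discriminant is a natural number and `isSqrt` applies; with
-- `p = q + d` the setting is that of `FactorError`. The larger of its two constants serves both
-- outputs.
split-error : ∀ {n p q k F} G → 1 ℕ.≤ k → q ℕ.< p → p ℕ.< 2 ℕ.* q → n ≡ p ℕ.* q →
  k ℕ.* k ℕ.+ G ℕ.* (4 ℕ.* n) ℕ.≤ G ℕ.* (k ℕ.* k) →
  IsSqrtFloor (+ k ℤ.* + k ℤ.- + n ℤ.* + 4) F →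
  let g = 5 ℕ.+ 3 ℕ.* G
      A = (+ k ℤ.+ F) ℤ./ℕ 2 in
  ℤ.∣ + p ℤ.- A ∣ ℕ.≤ g ℕ.* ℤ.∣ + (p ℕ.+ q) ℤ.- + k ∣ ×
  ℤ.∣ + q ℤ.- (+ k ℤ.- A) ∣ ℕ.≤ g ℕ.* ℤ.∣ + (p ℕ.+ q) ℤ.- + k ∣
split-error {p = p} {q} {k} G 1≤k q<p p<2q refl gap isSqrt
  with d , refl ← ℕₚ.m≤n⇒∃[o]m+o≡n (ℕₚ.<⇒≤ q<p)
  with f , refl , f²≤N , N<[1+f]² ←
    isSqrt (discriminant≡ k (p ℕ.* q) (ℕₚ.<⇒≤ (gap⇒4n<k² G k (p ℕ.* q) 1≤k gap))) =
  ℕₚ.≤-trans E.p-error (ℕₚ.*-monoˡ-≤ E.u (ℕₚ.n≤1+n (4 ℕ.+ 3 ℕ.* G))) , E.q-error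
  where
  m : ℕ
  m = 4 ℕ.* (p ℕ.* q)
  k²-m+m≡k² : k ℕ.* k ℕ.∸ m ℕ.+ m ≡ k ℕ.* k
  k²-m+m≡k² = ℕₚ.m∸n+n≡m (ℕₚ.<⇒≤ (gap⇒4n<k² G k (p ℕ.* q) 1≤k gap))
  module E = FactorError q d k f G
    (ℕₚ.+-cancelˡ-≤ q 1 d (subst (ℕ._≤ q ℕ.+ d) (ℕₚ.+-comm 1 q) q<p))
    (ℕₚ.+-cancelˡ-≤ q d q (subst (q ℕ.+ d ℕ.≤_) (cong (q ℕ.+_) (ℕₚ.+-identityʳ q)) (ℕₚ.<⇒≤ p<2q)))
    1≤k gap
    (subst (f ℕ.* f ℕ.+ m ℕ.≤_) k²-m+m≡k² (ℕₚ.+-monoˡ-≤ m f²≤N))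
    (subst (ℕ._< suc f ℕ.* suc f ℕ.+ m) k²-m+m≡k² (ℕₚ.+-monoˡ-< m N<[1+f]²))

splitting-error : ∀ {n p q K k} G → K ≡ + k → 1 ℕ.≤ k → q ℕ.< p → p ℕ.< 2 ℕ.* q → n ≡ p ℕ.* q →
  k ℕ.* k ℕ.+ G ℕ.* (4 ℕ.* n) ℕ.≤ G ℕ.* (k ℕ.* k) →
  let g = 5 ℕ.+ 3 ℕ.* G
      KpKq = result splitting (+ n ∷ K ∷ []) in
  ℤ.∣ + p ℤ.- lookup KpKq 0F ∣ ℕ.≤ g ℕ.* ℤ.∣ + (p ℕ.+ q) ℤ.- K ∣ ×
  ℤ.∣ + q ℤ.- lookup KpKq 1F ∣ ℕ.≤ g ℕ.* ℤ.∣ + (p ℕ.+ q) ℤ.- K ∣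
splitting-error {n} {k = k} G refl 1≤k q<p p<2q n≡pq gap =
  let _ , _ , _ , _ , _ , _ , isSqrt = SplitBounds.execution (+ n) (+ k)
  in split-error G 1≤k q<p p<2q n≡pq gap isSqrt

-- `IsApprox-transfer` bounds a new error by a multiple of a single old one; the disjunction selects
-- the larger of the two old errors.
sum-error : ∀ p q K L →
  ℤ.∣ + (p ℕ.+ q) ℤ.- (K ℤ.+ L) ∣ ℕ.≤ 2 ℕ.* ℤ.∣ + p ℤ.- K ∣ ⊎
  ℤ.∣ + (p ℕ.+ q) ℤ.- (K ℤ.+ L) ∣ ℕ.≤ 2 ℕ.* ℤ.∣ + q ℤ.- L ∣
sum-error p q K L =
  [ (λ i≤j → inj₂ (ℕₚ.≤-trans triangle (ℕₚ.≤-trans (ℕₚ.+-monoˡ-≤ j i≤j) (double j))))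
  , (λ j≤i → inj₁ (ℕₚ.≤-trans triangle (ℕₚ.≤-trans (ℕₚ.+-monoʳ-≤ i j≤i) (double i))))
  ]′ (ℕₚ.≤-total i j)
  where
  i j : ℕ
  i = ℤ.∣ + p ℤ.- K ∣
  j = ℤ.∣ + q ℤ.- L ∣
  regroup : ∀ P Q K L → P ℤ.+ Q ℤ.- (K ℤ.+ L) ≡ (P ℤ.- K) ℤ.+ (Q ℤ.- L)
  regroup = ℤ-Ring.solve-∀
  triangle : ℤ.∣ + (p ℕ.+ q) ℤ.- (K ℤ.+ L) ∣ ℕ.≤ i ℕ.+ j
  triangle = ℕₚ.≤-trans (ℕₚ.≤-reflexive (cong ℤ.∣_∣ (regroup (+ p) (+ q) K L)))
    (ℤₚ.∣i+j∣≤∣i∣+∣j∣ (+ p ℤ.- K) (+ q ℤ.- L))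
  double : ∀ x → x ℕ.+ x ℕ.≤ 2 ℕ.* x
  double x = ℕₚ.≤-reflexive (cong (x ℕ.+_) (sym (ℕₚ.+-identityʳ x)))

-- The ratio 3 in `IsApprox-transfer` is dictated by `p + q < 2 q + q`.
module Comparable {p q : ℕ} (pp : Prime p) (pq : Prime q) (q<p : q ℕ.< p) (p<2q : p ℕ.< 2 ℕ.* q) where
  1<p : 1 ℕ.< p
  1<p = ℕ.nonTrivial⇒n>1 p ⦃ prime⇒nonTrivial pp ⦄
  1<q : 1 ℕ.< q
  1<q = ℕ.nonTrivial⇒n>1 q ⦃ prime⇒nonTrivial pq ⦄
  1≤p : 1 ℕ.≤ p
  1≤p = ℕₚ.<⇒≤ 1<p
  1≤q : 1 ℕ.≤ q
  1≤q = ℕₚ.<⇒≤ 1<q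
  1≤p+q : 1 ℕ.≤ p ℕ.+ q
  1≤p+q = ℕₚ.≤-trans 1≤p (ℕₚ.m≤m+n p q)
  p≤3[p+q] : p ℕ.≤ 3 ℕ.* (p ℕ.+ q)
  p≤3[p+q] = ℕₚ.≤-trans (ℕₚ.m≤m+n p q) (ℕₚ.m≤n*m (p ℕ.+ q) 3)
  q≤3[p+q] : q ℕ.≤ 3 ℕ.* (p ℕ.+ q)
  q≤3[p+q] = ℕₚ.≤-trans (ℕₚ.m≤n+m q p) (ℕₚ.m≤n*m (p ℕ.+ q) 3)
  p+q≤3p : p ℕ.+ q ℕ.≤ 3 ℕ.* p
  p+q≤3p = ℕₚ.+-monoʳ-≤ p (ℕₚ.≤-trans (ℕₚ.<⇒≤ q<p) (ℕₚ.m≤m+n p _))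
  p+q≤3q : p ℕ.+ q ℕ.≤ 3 ℕ.* q
  p+q≤3q = ℕₚ.≤-trans (ℕₚ.+-monoˡ-≤ q (ℕₚ.<⇒≤ p<2q)) (ℕₚ.≤-reflexive (ℕₚ.+-comm (2 ℕ.* q) q))

proposition4p4 : (δ : ℝ) → fromℤ (+ 0) <ᴿ cut δ →
    ((κ : ℝ) → fromℤ (+ 2) <ᴿ cut κ →
    Σ (PolyTimeAlgorithm 2 2) λ A →
    (C : ℝ) → fromℤ (+ 0) <ᴿ cut C →
    Σ ℝ λ c → fromℤ (+ 0) <ᴿ cut c ×
    ((n p q : ℕ) (K : ℤ) →
    Prime p → Prime q → q ℕ.< p → p ℕ.< 2 ℕ.* q → n ≡ p ℕ.* q →
    cut κ *ᴿ (√ n) ≤ᴿ fromℤ K →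
    IsApprox δ C (p ℕ.+ q) K →
    IsApprox δ c p (lookup (result A (+ n ∷ K ∷ [])) 0F) ×
    IsApprox δ c q (lookup (result A (+ n ∷ K ∷ [])) 1F)))
    ×
    (Σ (PolyTimeAlgorithm 3 1) λ A →
    (C : ℝ) → fromℤ (+ 0) <ᴿ cut C →
    Σ ℝ λ c → fromℤ (+ 0) <ᴿ cut c ×
    ((n p q : ℕ) (Kp Kq : ℤ) →
    Prime p → Prime q → q ℕ.< p → p ℕ.< 2 ℕ.* q → n ≡ p ℕ.* q →
    IsApprox δ C p Kp →
    IsApprox δ C q Kq →
    IsApprox δ c (p ℕ.+ q) (lookup (result A (+ n ∷ Kp ∷ Kq ∷ [])) 0F)))
proposition4p4 δ 0<δ =
  (λ κ 2<κ → let G , gap = κ-gap κ 2<κ in splitting , λ C 0<C →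
    -- The constant depends on `δ`, `C` and, through `G`, on `κ`; it is fixed before `n`, `p`, `q`
    -- and `K` are given.
    let c , 0<c , transfer = IsApprox-transfer δ 0<δ C 0<C (5 ℕ.+ 3 ℕ.* G) (ℕ.s≤s ℕ.z≤n) in
    c , 0<c , λ n p q K pp pq q<p p<2q n≡pq κ√n≤K approx →
    let open Comparable pp pq q<p p<2q
        k , K≡k , 1≤k , gap-k = gap {n} {K} (subst (1 ℕ.<_) (sym n≡pq) (ℕₚ.*-mono-< 1<p 1<q)) κ√n≤K
        p-error , q-error = splitting-error G K≡k 1≤k q<p p<2q n≡pq gap-k
        KpKq = result splitting (+ n ∷ K ∷ [])
    in transfer (p ℕ.+ q) p K (lookup KpKq 0F) 1≤p+q 1≤p p+q≤3p p≤3[p+q] p-error approx ,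
       transfer (p ℕ.+ q) q K (lookup KpKq 1F) 1≤p+q 1≤q p+q≤3q q≤3[p+q] q-error approx) ,
  (addition , λ C 0<C →
    let c , 0<c , transfer = IsApprox-transfer δ 0<δ C 0<C 2 (ℕ.s≤s ℕ.z≤n) in
    c , 0<c , λ n p q Kp Kq pp pq q<p p<2q _ approx-p approx-q →
    let open Comparable pp pq q<p p<2q in
    [ (λ error → transfer p (p ℕ.+ q) Kp (Kp ℤ.+ Kq) 1≤p 1≤p+q p≤3[p+q] p+q≤3p error approx-p)
    , (λ error → transfer q (p ℕ.+ q) Kq (Kp ℤ.+ Kq) 1≤q 1≤p+q q≤3[p+q] p+q≤3q error approx-q)
    ]′ (sum-error p q Kp Kq))
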